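{- Let $\ell,r\ge1$ be integers and let $p$ be a divisor of $r$ that does not divide $\ell$. Let $\mathtt{A}^{\pm}_p(\ell,r)$ be the number of attractors of period $p$ of the canonical negative-positive double Boolean automata circuit $D_{\ell,r}$ (negative left-circuit of size $\ell$, positive right-circuit of size $r$), and let $$\mathtt{A}^+_p=\frac1p\sum_{d\mid p}\mu\!\left(\frac pd\right)2^d .$$ If $p\ne2$, then $$\mathtt{A}^{\pm}_p(\ell,r)<2\cdot\left(\frac{\sqrt3}{2}\right)^p\cdot\mathtt{A}^+_p,$$ and if $p=2$, then $\mathtt{A}^{\pm}_2(\ell,r)=1=\mathtt{A}^+_2$.
   Context: The canonical negative-positive double Boolean automata circuit $D_{\ell,r}$ has $n=\ell+r-1$ nodes $0,\ldots,n-1$. For a configuration $x=(x_0,\ldots,x_{n-1})\in\{0,1\}^n$ write $x^L=(x_0,\ldots,x_{\ell-1})$ (states of the left-circuit) and $x^R=(x_0,x_\ell,\ldots,x_{n-1})$ (states of the right-circuit, $r$ entries). All nodes are updated in parallel by $F:\{0,1\}^n\to\{0,1\}^n$: $F(x)_i=x_{i-1}$ for $i\notin\{0,\ell\}$; $F(x)_\ell=x_0$ (if $r\ge2$); and $F(x)_0=\neg a\vee b$, where $a=x_{\ell-1}$ is the last entry of $x^L$ and $b$ is the last entry of $x^R$ (so $b=x_{n-1}$ when $r\ge 2$). A configuration $x$ has period $p$ if $F^{p}(x)=x$; it has exact period $p$ if moreover it has no period $d<p$, $d\ge1$. An attractor of period $p$ is the orbit under $F$ of a configuration of exact period $p$.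 $\mu$ is the Möbius function. The number $\mathtt{A}^+_p$ is the number of attractors of period $p$ of an isolated positive Boolean automata circuit whose size is a multiple of $p$. -}

module Defs where

open import Data.Bool.Base using (Bool; true; false; not; _∨_; if_then_else_)
import Data.Bool.Properties as Bool
open import Data.Fin.Base using (Fin; zero; suc; toℕ; inject₁)
open import Data.Integer.Base as ℤ using (ℤ; 0ℤ; -1ℤ)
open import Data.List.Base as List using (List; []; _∷_; filter; map; foldr; length; upTo; deduplicate; cartesianProductWith)
import Data.List.Membership.DecPropositional as DecMembership
import Data.List.Properties as List
import Data.List.Relation.Unary.Unique.DecPropositional as DecUnique
open import Data.Nat.Base using (ℕ; zero; suc; _+_; _/_; _^_; _≡ᵇ_; _≤_; _<_; NonZero)
open import Data.Nat.Divisibility using (_∣?_)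
open import Data.Nat.GeneralisedArithmetic using (iterate)
open import Data.Nat.Primality.Factorisation using (factorise; module PrimeFactorisation)
open import Data.Nat.Properties using (_≟_; _≤?_; allUpTo?)
open import Data.Product.Base using (_×_)
open import Data.Rational.Base as ℚ using (ℚ; 0ℚ; 1ℚ; ½)
open import Data.Vec.Base as Vec using (Vec; []; _∷_; head; tail; last; lookup; tabulate; take; drop)
import Data.Vec.Properties as Vec
open import Relation.Binary.Definitions using (DecidableEquality)
open import Relation.Binary.PropositionalEquality using (_≡_)
open import Relation.Nullary using (¬_; Dec; does)
open import Relation.Nullary.Decidable using (¬?; _×-dec_; _→-dec_)

Config : ℕ → Set
Config n = Vec Bool n

_≟ᶜ_ : ∀ {n} → DecidableEquality (Config n)
_≟ᶜ_ = Vec.≡-dec Bool._≟_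

allConfigs : ∀ n → List (Config n)
allConfigs zero    = [] ∷ []
allConfigs (suc n) = cartesianProductWith _∷_ (false ∷ true ∷ []) (allConfigs n)

-- The circuit D_{ℓ,r} with ℓ = suc l and r = suc s, so that ℓ , r ≥ 1 and
-- n = ℓ + r - 1 = suc (l + s).
module Circuit (l s : ℕ) where

  ℓ r n : ℕ
  ℓ = suc l
  r = suc s
  n = suc (l + s)

  xᴸ : Config n → Vec Bool ℓ
  xᴸ x = head x ∷ take l (tail x)

  xᴿ : Config n → Vec Bool r
  xᴿ x = head x ∷ drop l (tail x)

  local : Config n → Fin n → Bool
  local x zero    = not (last (xᴸ x)) ∨ last (xᴿ x)
  local x (suc i) = if suc (toℕ i) ≡ᵇ ℓ then head x else lookup x (inject₁ i)

  F : Config n → Config n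
  F x = tabulate (local x)

  HasPeriod : ℕ → Config n → Set
  HasPeriod p x = iterate F x p ≡ x

  HasExactPeriod : ℕ → Config n → Set
  HasExactPeriod p x = HasPeriod p x × (∀ {d} → d < p → 1 ≤ d → ¬ HasPeriod d x)

  hasPeriod? : ∀ p x → Dec (HasPeriod p x)
  hasPeriod? p x = iterate F x p ≟ᶜ x

  hasExactPeriod? : ∀ p x → Dec (HasExactPeriod p x)
  hasExactPeriod? p x =
    hasPeriod? p x ×-dec allUpTo? (λ d → (1 ≤? d) →-dec ¬? (hasPeriod? d x)) p

  -- The set {x , F x , … , Fᵖ⁻¹ x}, which is the whole orbit of x when x has
  -- period p ≥ 1.  A set of configurations is represented by the list of its
  -- elements in the order of allConfigs, so equal sets are equal lists.
  orbit : ℕ → Config n → List (Config n)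
  orbit p x = filter (_∈? List.iterate F x p) (allConfigs n)
    where open DecMembership (_≟ᶜ_ {n})

  attractors : ℕ → List (List (Config n))
  attractors p =
    deduplicate (List.≡-dec _≟ᶜ_) (map (orbit p) (filter (hasExactPeriod? p) (allConfigs n)))

A± : (ℓ r : ℕ) .{{_ : NonZero ℓ}} .{{_ : NonZero r}} → ℕ → ℕ
A± (suc l) (suc s) p = length (Circuit.attractors l s p)

-- The value at 0 is a convention and is never used.
μ : ℕ → ℤ
μ zero      = 0ℤ
μ m@(suc _) = if does (unique? ps) then -1ℤ ℤ.^ length ps else 0ℤ
  where
  open DecUnique _≟_
  ps : List ℕ
  ps = PrimeFactorisation.factors (factorise m)

-- Σ_{d ∣ p} μ(p/d) 2ᵈ, with d written as suc i.
möbiusSum : ℕ → ℤ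
möbiusSum p =
  foldr ℤ._+_ 0ℤ
    (map (λ i → μ (p / suc i) ℤ.* ℤ.+ (2 ^ suc i)) (filter (λ i → suc i ∣? p) (upTo p)))

A⁺ : (p : ℕ) .{{_ : NonZero p}} → ℚ
A⁺ p = möbiusSum p ℚ./ p

-- The ordered field ℚ(√3) ⊂ ℝ, with √3 the positive root;
-- a +√3· b stands for the real number a + b√3.
infix 5 _+√3·_
record ℚ[√3] : Set where
  constructor _+√3·_
  field
    rat irr : ℚ

3ℚ : ℚ
3ℚ = ℤ.+ 3 ℚ./ 1

fromℚ : ℚ → ℚ[√3]
fromℚ a = a +√3· 0ℚ

fromℕ : ℕ → ℚ[√3]
fromℕ k = fromℚ (ℤ.+ k ℚ./ 1)

√3 : ℚ[√3]
√3 = 0ℚ +√3· 1ℚ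

infixl 6 _-√_
infixl 7 _*√_
infixr 8 _^√_
infix  4 _<√_

_-√_ : ℚ[√3] → ℚ[√3] → ℚ[√3]
(a +√3· b) -√ (c +√3· d) = (a ℚ.- c) +√3· (b ℚ.- d)

_*√_ : ℚ[√3] → ℚ[√3] → ℚ[√3]
(a +√3· b) *√ (c +√3· d) =
  (a ℚ.* c ℚ.+ 3ℚ ℚ.* (b ℚ.* d)) +√3· (a ℚ.* d ℚ.+ b ℚ.* c)

_^√_ : ℚ[√3] → ℕ → ℚ[√3]
x ^√ zero  = fromℕ 1
x ^√ suc k = x *√ x ^√ k

√3/2 : ℚ[√3]
√3/2 = fromℚ ½ *√ √3

-- The order induced from ℝ: when a and b have opposite signs, the sign of
-- a + b√3 is found by comparing a² with 3b².
data Positive : ℚ[√3] → Set where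
  pos-pos : ∀ {a b} → 0ℚ ℚ.≤ a → 0ℚ ℚ.≤ b → 0ℚ ℚ.< a ℚ.+ b → Positive (a +√3· b)
  pos-neg : ∀ {a b} → 0ℚ ℚ.< a → b ℚ.< 0ℚ → 3ℚ ℚ.* (b ℚ.* b) ℚ.< a ℚ.* a → Positive (a +√3· b)
  neg-pos : ∀ {a b} → a ℚ.< 0ℚ → 0ℚ ℚ.< b → a ℚ.* a ℚ.< 3ℚ ℚ.* (b ℚ.* b) → Positive (a +√3· b)

_<√_ : ℚ[√3] → ℚ[√3] → Set
x <√ y = Positive (y -√ x)

{-# OPTIONS --safe #-}
-- Write u(t) for the state of node 0 at time t.  On an orbit of period p every node carries a
-- delayed copy of u, so the orbit is determined by the p-periodic sequence u, and p ∣ r turns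
-- the rule of node 0 into u(t) = ¬ u(t - ℓ) ∨ u(t): no two zeros of u are at distance ℓ.
-- With Δ = gcd ℓ p and k = p/Δ ≥ 2, the translations by ℓ split ℤ/p into Δ cycles of length k,
-- so there are at most (L_k)^Δ such u, where L_k is the Lucas number counting the cyclic words
-- without consecutive zeros.  As L_k² ≤ 3ᵏ for k ≥ 2, this gives (p · A±)² ≤ 3ᵖ.  On the other
-- side, proper divisors of p are at most p/2, whence p · A⁺ > 2ᵖ⁻¹ for p ≥ 3.
module Submission where

-- The constant √3 comes from k = 2: the inequality L_k² ≤ 3ᵏ says that the k-th root of L_k is at
-- most √3, and L_2 = 3 attains this value. Since that bound can be sharp, strictness is drawn from
-- the other side, from p · A⁺ > 2ᵖ⁻¹. At p = 2 the two sides of the latter are equal (4 - 2 = 2),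
-- so this period is settled by describing its only attractor. On the circuit side there is no
-- Möbius inversion: p · A± is bounded by the number of all configurations with Fᵖ x = x, smaller
-- exact periods included, and this loss is affordable. The square of p · A± is compared with 3ᵖ so
-- that the counting stays in ℕ. The field ℚ(√3) enters only at the end, where (√3/2)ᵖ is rational
-- for even p and a rational multiple of √3 for odd p.

open import Defs
open import Data.Bool.Base using (Bool; true; false; not; _∨_; _xor_; if_then_else_; T)
open import Data.Bool.Properties as Bool using (not-involutive; ¬-not)
open import Data.Empty using (⊥-elim)
open import Data.Fin.Base as Fin using (Fin; zero; suc; toℕ; inject₁; fromℕ<; _↑ˡ_; _↑ʳ_)
open import Data.Fin.Properties using (toℕ-inject₁; toℕ-↑ˡ; toℕ-↑ʳ; toℕ-fromℕ; toℕ-fromℕ<)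
open import Data.Integer.Base as ℤ using (ℤ; -[1+_]; 0ℤ; -1ℤ; ∣_∣)
import Data.Integer.Properties as ℤ
open import Data.List.Base as List using (List; []; _∷_; _++_; length; map; filter; foldr; concat; cartesianProductWith; applyUpTo; upTo)
import Data.List.Membership.DecPropositional as DecMembership
open import Data.List.Membership.Propositional using (_∈_)
open import Data.List.Membership.Propositional.Properties
open import Data.List.Properties as List using (length-++; length-map; length-iterate; filter-≐; filter-++; filter-accept; filter-reject; map-++; upTo-∷ʳ; ++-identityʳ)
open import Data.List.Relation.Binary.Disjoint.Propositional using (Disjoint)
open import Data.List.Relation.Unary.All as All using (All; []; _∷_)
open import Data.List.Relation.Unary.AllPairs using (AllPairs; []; _∷_)
open import Data.List.Relation.Unary.Any using (here; there)
import Data.List.Relation.Unary.Unique.DecPropositional as DecUnique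
import Data.List.Relation.Unary.Unique.DecPropositional.Properties as DecUnique
open import Data.List.Relation.Unary.Unique.Propositional using (Unique)
import Data.List.Relation.Unary.Unique.Propositional.Properties as Unique
open import Data.Nat.Base
open import Data.Nat.Divisibility using (_∣_; _∣?_; divides; ∣-refl; 1∣_)
open import Data.Nat.DivMod using (m≡m%n+[m/n]*n; m%n<n; n/n≡1)
open import Data.Nat.GCD using (gcd; gcd-GCD; gcd[m,n]∣m; gcd[m,n]∣n; module Bézout)
open import Data.Nat.GeneralisedArithmetic using (iterate)
open import Data.Nat.ListAction using (sum)
open import Data.Nat.ListAction.Properties using (sum-++)
open import Data.Nat.Primality.Factorisation using (factorise; module PrimeFactorisation)
open import Data.Nat.Properties
open import Data.Nat.Tactic.RingSolver using (solve-∀)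
open import Data.Product.Base using (∃; ∃-syntax; _×_; _,_; proj₂)
open import Data.Rational.Base as ℚ using (ℚ; 0ℚ; 1ℚ; ½; toℚᵘ)
import Data.Rational.Properties as ℚ
import Data.Rational.Solver as ℚ-Solver
open import Data.Rational.Unnormalised.Base as ℚᵘ using (mkℚᵘ)
import Data.Rational.Unnormalised.Properties as ℚᵘ
open import Data.Sum.Base using (_⊎_; inj₁; inj₂)
open import Data.Vec.Base using (Vec; []; _∷_; head; tail; last; lookup; tabulate; take; drop)
open import Data.Vec.Properties using (∷-injective; lookup∘tabulate; tabulate∘lookup; tabulate-cong)
open import Data.Vec.Relation.Unary.All as VecAll using ([]; _∷_)
open import Data.Vec.Relation.Unary.All.Properties using (tabulate⁺)
open import Function.Base using (_∘_; id; it)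
open import Relation.Binary.PropositionalEquality using (_≡_; _≢_; refl; sym; trans; cong; cong₂; subst; subst₂; module ≡-Reasoning)
open import Relation.Nullary using (¬_; yes; no; does)

-- Counting in lists

private
  variable
    A B C : Set

-- Induction on `xs`, cutting the image of the head out of `ys`. Injectivity is asked only on
-- members of `xs`, because `encode` below is injective only on periodic configurations.
length-≤ : ∀ {xs : List A} {ys : List B} (f : A → B) → Unique xs →
           (∀ {x} → x ∈ xs → f x ∈ ys) →
           (∀ {x y} → x ∈ xs → y ∈ xs → f x ≡ f y → x ≡ y) →
           length xs ≤ length ys
length-≤ f [] into inj = z≤n
length-≤ {xs = x ∷ xs} {ys} f (x∉xs ∷ xs!) into inj
  with ∈-∃++ (into (here refl))
... | as , bs , refl = ≤-trans (s≤s (length-≤ f xs! into′ inj′)) (≤-reflexive (sym length-middle))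
  where
  inj′ : ∀ {y z} → y ∈ xs → z ∈ xs → f y ≡ f z → y ≡ z
  inj′ y∈ z∈ = inj (there y∈) (there z∈)

  into′ : ∀ {y} → y ∈ xs → f y ∈ as ++ bs
  into′ {y} y∈ with ∈-++⁻ as (into (there y∈))
  ... | inj₁ fy∈as         = ∈-++⁺ˡ fy∈as
  -- A later element with the image of the head would be equal to the head, against uniqueness.
  ... | inj₂ (here fy≡fx)  = ⊥-elim (All.lookup x∉xs y∈ (sym (inj (there y∈) (here refl) fy≡fx)))
  ... | inj₂ (there fy∈bs) = ∈-++⁺ʳ as fy∈bs

  length-middle : length (as ++ f x ∷ bs) ≡ suc (length (as ++ bs))
  length-middle = trans (length-++ as) (trans (+-suc (length as) (length bs)) (cong suc (sym (length-++ as))))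

length-concat-≥ : ∀ {p} {xss : List (List A)} → All (λ xs → p ≤ length xs) xss →
                  length xss * p ≤ length (concat xss)
length-concat-≥ [] = z≤n
length-concat-≥ {xss = xs ∷ _} (p≤ ∷ ps) =
  ≤-trans (+-mono-≤ p≤ (length-concat-≥ ps)) (≤-reflexive (sym (length-++ xs)))

length-cartesianProductWith : ∀ (f : A → B → C) xs ys →
                              length (cartesianProductWith f xs ys) ≡ length xs * length ys
length-cartesianProductWith f []       ys = refl
length-cartesianProductWith f (x ∷ xs) ys =
  trans (length-++ (map (f x) ys))
        (cong₂ _+_ (length-map (f x) ys) (length-cartesianProductWith f xs ys))

vectors : ∀ n → List A → List (Vec A n)
vectors zero    xs = [] ∷ []
vectors (suc n) xs = cartesianProductWith _∷_ xs (vectors n xs)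

length-vectors : ∀ n (xs : List A) → length (vectors n xs) ≡ length xs ^ n
length-vectors zero    xs = refl
length-vectors (suc n) xs =
  trans (length-cartesianProductWith _∷_ xs (vectors n xs)) (cong (length xs *_) (length-vectors n xs))

∈-vectors : ∀ {n} {xs : List A} {v : Vec A n} → VecAll.All (_∈ xs) v → v ∈ vectors n xs
∈-vectors []       = here refl
∈-vectors (a ∷ as) = ∈-cartesianProductWith⁺ _∷_ a (∈-vectors as)

allConfigs-complete : ∀ {n} (x : Config n) → x ∈ allConfigs n
allConfigs-complete []      = here refl
allConfigs-complete (b ∷ x) = ∈-cartesianProductWith⁺ _∷_ (b∈ b) (allConfigs-complete x)
  where
  b∈ : ∀ b → b ∈ false ∷ true ∷ []
  b∈ false = here refl
  b∈ true  = there (here refl)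

allConfigs-unique : ∀ n → Unique (allConfigs n)
allConfigs-unique zero    = [] ∷ []
allConfigs-unique (suc n) =
  Unique.cartesianProductWith⁺ _∷_ ∷-injective (((λ ()) ∷ []) ∷ [] ∷ []) (allConfigs-unique n)

-- Orbits and attractors

iterate-+ : ∀ {A : Set} (f : A → A) m {n} x → iterate f x (m + n) ≡ iterate f (iterate f x m) n
iterate-+ f zero    x = refl
iterate-+ f (suc m) x = iterate-+ f m (f x)

iterate-* : ∀ {A : Set} (f : A → A) {p x} m → iterate f x p ≡ x → iterate f x (m * p) ≡ x
iterate-* f         zero    x≡ = refl
iterate-* f {p} {x} (suc m) x≡ =
  trans (iterate-+ f p x) (trans (cong (λ y → iterate f y (m * p)) x≡) (iterate-* f m x≡))

iterate-period : ∀ {A : Set} (f : A → A) {p x} m n → iterate f x p ≡ x →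
                 iterate f x (m * p + n) ≡ iterate f x n
iterate-period f {p} {x} m n x≡ =
  trans (iterate-+ f (m * p) x) (cong (λ y → iterate f y n) (iterate-* f m x≡))

iterate≡applyUpTo : ∀ {A : Set} (f : A → A) x n → List.iterate f x n ≡ applyUpTo (iterate f x) n
iterate≡applyUpTo f x zero    = refl
iterate≡applyUpTo f x (suc n) = cong (x ∷_) (iterate≡applyUpTo f (f x) n)

module _ {A : Set} (f : A → A) {p : ℕ} where

  ∈-iterate⁻ : ∀ {x y} → y ∈ List.iterate f x p → ∃ λ t → y ≡ iterate f x t
  ∈-iterate⁻ {x} y∈ with ∈-applyUpTo⁻ (iterate f x) (subst (_ ∈_) (iterate≡applyUpTo f x p) y∈)
  ... | t , _ , y≡ = t , y≡

  module _ .{{_ : NonZero p}} {x : A} (x≡ : iterate f x p ≡ x) where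

    iterate-% : ∀ t → iterate f x t ≡ iterate f x (t % p)
    iterate-% t = trans (cong (iterate f x) (trans (m≡m%n+[m/n]*n t p) (+-comm (t % p) _)))
                        (iterate-period f (t / p) (t % p) x≡)

    ∈-iterate⁺ : ∀ t → iterate f x t ∈ List.iterate f x p
    ∈-iterate⁺ t = subst (iterate f x t ∈_) (sym (iterate≡applyUpTo f x p))
                     (subst (_∈ applyUpTo (iterate f x) p) (sym (iterate-% t))
                       (∈-applyUpTo⁺ (iterate f x) (m%n<n t p)))

    iterate-preserves-period : ∀ t → iterate f (iterate f x t) p ≡ iterate f x t
    iterate-preserves-period t = begin
      iterate f (iterate f x t) p ≡⟨ iterate-+ f t x ⟨
      iterate f x (t + p)         ≡⟨ cong (iterate f x) (+-comm t p) ⟩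
      iterate f x (p + t)         ≡⟨ iterate-+ f p x ⟩
      iterate f (iterate f x p) t ≡⟨ cong (λ y → iterate f y t) x≡ ⟩
      iterate f x t               ∎
      where open ≡-Reasoning

    -- After `t` steps, `t * p ∸ t` more complete `t` full turns. As `t ≤ t * p`, this witness works
    -- without first reducing `t` modulo `p`.
    return : ∀ t → iterate f (iterate f x t) (t * p ∸ t) ≡ x
    return t = begin
      iterate f (iterate f x t) (t * p ∸ t) ≡⟨ iterate-+ f t x ⟨
      iterate f x (t + (t * p ∸ t))         ≡⟨ cong (iterate f x) (m+[n∸m]≡n (m≤m*n t p)) ⟩
      iterate f x (t * p)                   ≡⟨ iterate-* f t x≡ ⟩
      x                                     ∎
      where open ≡-Reasoning

    iterate-unique : (∀ {d} → d < p → 1 ≤ d → iterate f x d ≢ x) → Unique (List.iterate f x p)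
    iterate-unique minimal =
      subst Unique (sym (iterate≡applyUpTo f x p)) (Unique.applyUpTo⁺₁ (iterate f x) p distinct)
      where
      distinct : ∀ {i j} → i < j → j < p → iterate f x i ≢ iterate f x j
      -- A repetition `i < j` shortens the turn: `i` steps, then the `p ∸ j` steps leading from the
      -- `j`-th iterate back to `x`, make a period below `p`.
      distinct {i} {j} i<j j<p fⁱ≡fʲ = minimal d<p 1≤d (begin
        iterate f x (i + (p ∸ j))         ≡⟨ iterate-+ f i x ⟩
        iterate f (iterate f x i) (p ∸ j) ≡⟨ cong (λ y → iterate f y (p ∸ j)) fⁱ≡fʲ ⟩
        iterate f (iterate f x j) (p ∸ j) ≡⟨ iterate-+ f j x ⟨
        iterate f x (j + (p ∸ j))         ≡⟨ cong (iterate f x) (m+[n∸m]≡n (<⇒≤ j<p)) ⟩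
        iterate f x p                     ≡⟨ x≡ ⟩
        x                                 ∎)
        where
        open ≡-Reasoning
        d<p : i + (p ∸ j) < p
        d<p = <-≤-trans (+-monoˡ-< (p ∸ j) i<j) (≤-reflexive (m+[n∸m]≡n (<⇒≤ j<p)))
        1≤d : 1 ≤ i + (p ∸ j)
        1≤d = ≤-trans (m<n⇒0<n∸m j<p) (m≤n+m (p ∸ j) i)

  iterates-same : .{{_ : NonZero p}} → ∀ {x y z} → iterate f x p ≡ x → ∀ t → y ≡ iterate f x t →
                  z ∈ List.iterate f x p → z ∈ List.iterate f y p
  iterates-same {x} {y} x≡ t refl z∈ with ∈-iterate⁻ z∈
  ... | s , refl =
    subst (_∈ List.iterate f y p)
      (trans (iterate-+ f (t * p ∸ t) y) (cong (λ w → iterate f w s) (return x≡ t)))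
      (∈-iterate⁺ (iterate-preserves-period x≡ t) (t * p ∸ t + s))

module _ (l s : ℕ) where
  open Circuit l s
  open DecMembership (_≟ᶜ_ {n}) using (_∈?_)

  module _ {p : ℕ} where

    ∈-orbit⁻ : ∀ {x y} → y ∈ orbit p x → y ∈ List.iterate F x p
    ∈-orbit⁻ {x} y∈ = proj₂ (∈-filter⁻ (_∈? List.iterate F x p) {xs = allConfigs n} y∈)

    ∈-orbit⁺ : ∀ {x y} → y ∈ List.iterate F x p → y ∈ orbit p x
    ∈-orbit⁺ {x} {y} = ∈-filter⁺ (_∈? List.iterate F x p) (allConfigs-complete y)

    orbit-unique : ∀ x → Unique (orbit p x)
    orbit-unique x = Unique.filter⁺ (_∈? List.iterate F x p) (allConfigs-unique n)

    attractors-unique : Unique (attractors p)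
    attractors-unique = DecUnique.deduplicate-! (List.≡-dec _≟ᶜ_) _

    ∈-attractors⁻ : ∀ {o} → o ∈ attractors p → ∃ λ x → HasExactPeriod p x × o ≡ orbit p x
    ∈-attractors⁻ o∈
      with x , x∈ , o≡ ← ∈-map⁻ (orbit p) (∈-deduplicate⁻ (List.≡-dec _≟ᶜ_) _ o∈)
      = x , proj₂ (∈-filter⁻ (hasExactPeriod? p) {xs = allConfigs n} x∈) , o≡

    ∈-attractors⁺ : ∀ {x} → HasExactPeriod p x → orbit p x ∈ attractors p
    ∈-attractors⁺ {x} ex = ∈-deduplicate⁺ (List.≡-dec _≟ᶜ_)
      (∈-map⁺ (orbit p) (∈-filter⁺ (hasExactPeriod? p) (allConfigs-complete x) ex))

    module _ .{{_ : NonZero p}} where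

      -- An orbit is a filter of the fixed list `allConfigs n`, so equal membership, shown in both
      -- directions by `iterates-same`, already gives equal lists.
      orbit-iterate : ∀ {x} → HasPeriod p x → ∀ t → orbit p x ≡ orbit p (iterate F x t)
      orbit-iterate {x} x≡ t = filter-≐ (_∈? List.iterate F x p) (_∈? List.iterate F y p)
        ( iterates-same F x≡ t refl
        , iterates-same F (iterate-preserves-period F x≡ t) (t * p ∸ t) (sym (return F x≡ t)) )
        (allConfigs n)
        where y = iterate F x t

      orbits-meet : ∀ {x y z} → HasPeriod p x → HasPeriod p y →
                    z ∈ orbit p x → z ∈ orbit p y → orbit p x ≡ orbit p y
      orbits-meet x≡ y≡ z∈x z∈y
        with t , refl ← ∈-iterate⁻ F (∈-orbit⁻ z∈x) | u , eq ← ∈-iterate⁻ F (∈-orbit⁻ z∈y)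
        = trans (orbit-iterate x≡ t) (trans (cong (orbit p) eq) (sym (orbit-iterate y≡ u)))

      length-orbit : ∀ {x} → HasExactPeriod p x → p ≤ length (orbit p x)
      length-orbit {x} (x≡ , minimal) = ≤-trans (≤-reflexive (sym (length-iterate F x p)))
        (length-≤ id (iterate-unique F x≡ minimal) ∈-orbit⁺ (λ _ _ eq → eq))

      ∈-concat-attractors : ∀ {x} → x ∈ concat (attractors p) → HasPeriod p x
      ∈-concat-attractors x∈
        with o , x∈o , o∈ ← ∈-concat⁻′ (attractors p) x∈
        with y , (y≡ , _) , refl ← ∈-attractors⁻ o∈
        with t , refl ← ∈-iterate⁻ F (∈-orbit⁻ x∈o)
        = iterate-preserves-period F y≡ t

      concat-attractors-unique : Unique (concat (attractors p))
      concat-attractors-unique = Unique.concat⁺ (All.tabulate each) (disjoint attractors-unique id)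
        where
        each : ∀ {o} → o ∈ attractors p → Unique o
        each o∈ with y , _ , refl ← ∈-attractors⁻ o∈ = orbit-unique y

        disjoint₂ : ∀ {o o′} → o ∈ attractors p → o′ ∈ attractors p → o ≢ o′ → Disjoint o o′
        disjoint₂ o∈ o′∈ o≢ (z∈ , z∈′)
          with _ , (x≡ , _) , refl ← ∈-attractors⁻ o∈ | _ , (y≡ , _) , refl ← ∈-attractors⁻ o′∈
          = o≢ (orbits-meet x≡ y≡ z∈ z∈′)

        -- Stated for any `os` contained in the attractors, so that the recursion on tails keeps the
        -- exact periods at hand.
        disjoint : ∀ {os} → Unique os → (∀ {o} → o ∈ os → o ∈ attractors p) → AllPairs Disjoint os
        disjoint []          sub = []
        disjoint (o∉ ∷ os!) sub =
          All.tabulate (λ o′∈ → disjoint₂ (sub (here refl)) (sub (there o′∈)) (All.lookup o∉ o′∈))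
          ∷ disjoint os! (sub ∘ there)

      -- Distinct attractors are disjoint and each has at least `p` members, so their concatenation
      -- lists at least `length (attractors p) * p` different configurations of period `p`; any code
      -- that separates these bounds the product.
      attractors-bound : ∀ {B : Set} {ys : List B} (f : Config n → B) →
                         (∀ {x} → HasPeriod p x → f x ∈ ys) →
                         (∀ {x y} → HasPeriod p x → HasPeriod p y → f x ≡ f y → x ≡ y) →
                         length (attractors p) * p ≤ length ys
      attractors-bound f into inj = ≤-trans
        (length-concat-≥ (All.tabulate long))
        (length-≤ f concat-attractors-unique (into ∘ ∈-concat-attractors)
           (λ x∈ y∈ → inj (∈-concat-attractors x∈) (∈-concat-attractors y∈)))
        where
        long : ∀ {o} → o ∈ attractors p → p ≤ length o
        long o∈ with _ , ex , refl ← ∈-attractors⁻ o∈ = length-orbit ex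

-- The signal emitted by node 0

last-take : ∀ {A : Set} l {s} x (xs : Vec A (l + s)) →
            last (x ∷ take l xs) ≡ lookup (x ∷ xs) (Fin.fromℕ l ↑ˡ s)
last-take zero    x xs       = refl
last-take (suc l) x (y ∷ xs) = last-take l y xs

last≡lookup : ∀ {A : Set} {s} (xs : Vec A (suc s)) → last xs ≡ lookup xs (Fin.fromℕ s)
last≡lookup (x ∷ [])     = refl
last≡lookup (x ∷ y ∷ xs) = last≡lookup (y ∷ xs)

lookup-drop : ∀ {A : Set} l {s} (xs : Vec A (l + s)) i → lookup (drop l xs) i ≡ lookup xs (l ↑ʳ i)
lookup-drop zero    xs       i = refl
lookup-drop (suc l) (x ∷ xs) i = lookup-drop l xs i

head≡lookup : ∀ {A : Set} {n} (xs : Vec A (suc n)) → head xs ≡ lookup xs zero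
head≡lookup (x ∷ xs) = refl

lookup-injective : ∀ {A : Set} {n} (xs ys : Vec A n) → (∀ i → lookup xs i ≡ lookup ys i) → xs ≡ ys
lookup-injective xs ys eq = trans (sym (tabulate∘lookup xs)) (trans (tabulate-cong eq) (tabulate∘lookup ys))

≡ᵇ-refl : ∀ m → (m ≡ᵇ m) ≡ true
≡ᵇ-refl zero    = refl
≡ᵇ-refl (suc m) = ≡ᵇ-refl m

≢⇒≡ᵇ-false : ∀ {m n} → m ≢ n → (m ≡ᵇ n) ≡ false
≢⇒≡ᵇ-false {m} {n} m≢n with m ≡ᵇ n in eq
... | false = refl
... | true  = ⊥-elim (m≢n (≡ᵇ⇒≡ m n (subst T (sym eq) _)))

module Dynamics (l s : ℕ) where
  open Circuit l s

  -- The number of steps a signal takes from node 0 to a given node.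
  delay : ℕ → ℕ
  delay zero    = 0
  delay (suc i) = if suc i ≡ᵇ ℓ then 1 else suc (delay i)

  delay-left : ∀ {i} → i ≤ l → delay i ≡ i
  delay-left {zero}  _   = refl
  delay-left {suc i} i<l rewrite ≢⇒≡ᵇ-false (<⇒≢ i<l) = cong suc (delay-left (<⇒≤ i<l))

  delay-right : ∀ j → delay (l + suc j) ≡ suc j
  delay-right zero rewrite +-suc l 0 | +-identityʳ l | ≡ᵇ-refl l = refl
  delay-right (suc j) rewrite +-suc l (suc j)
    | ≢⇒≡ᵇ-false {l + suc j} {l} (λ eq → m+1+n≢m l eq) = cong suc (delay-right j)

  leftIndex : Fin n
  leftIndex = Fin.fromℕ l ↑ˡ s

  -- The node at the end of `xᴿ`; for `r = 1` the right circuit is a loop at node 0, whence the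
  -- separate case.
  rightIndex : ∀ s → Fin (suc (l + s))
  rightIndex zero    = zero
  rightIndex (suc s) = suc (l ↑ʳ Fin.fromℕ s)

  delay-leftIndex : delay (toℕ leftIndex) ≡ l
  delay-leftIndex = trans (cong delay (trans (toℕ-↑ˡ (Fin.fromℕ l) s) (toℕ-fromℕ l))) (delay-left ≤-refl)

  delay-rightIndex : ∀ s → delay (toℕ (rightIndex s)) ≡ s
  delay-rightIndex zero    = refl
  delay-rightIndex (suc s) = trans
    (cong delay (trans (cong suc (trans (toℕ-↑ʳ l (Fin.fromℕ s)) (cong (l +_) (toℕ-fromℕ s)))) (sym (+-suc l s))))
    (delay-right s)

  last-xᴸ : ∀ x → last (xᴸ x) ≡ lookup x leftIndex
  last-xᴸ (b ∷ x) = last-take l b x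

  last-xᴿ : ∀ x → last (xᴿ x) ≡ lookup x (rightIndex s)
  last-xᴿ = go s
    where
    go : ∀ s (x : Config (suc (l + s))) → last (head x ∷ drop l (tail x)) ≡ lookup x (rightIndex s)
    go zero    (b ∷ x) with drop l x
    ... | [] = refl
    go (suc s) (b ∷ x) = trans (last≡lookup (b ∷ drop l x)) (lookup-drop l x (Fin.fromℕ s))

  signal : Config n → ℕ → Bool
  signal x t = head (iterate F x t)

  iterate-F : ∀ x t → iterate F x (suc t) ≡ F (iterate F x t)
  iterate-F x t = trans (cong (iterate F x) (+-comm 1 t)) (iterate-+ F t x)

  -- Each node other than 0 copies its predecessor, or node 0 in the case of node `ℓ`. Adding the
  -- delay on the left avoids subtraction of times.
  signal-delay : ∀ x m i → lookup (iterate F x (delay (toℕ i) + m)) i ≡ signal x m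
  signal-delay x m i = go (toℕ i) i refl
    where
    -- The recursion runs on the number `k`, since `inject₁ i` is not structurally smaller than
    -- `suc i`.
    go : ∀ k i → toℕ i ≡ k → lookup (iterate F x (delay k + m)) i ≡ signal x m
    go zero    zero    _    = sym (head≡lookup (iterate F x m))
    go (suc k) (suc i) i≡ with suc k ≡ᵇ ℓ in eq
    ... | true  = begin
      lookup (iterate F x (suc m)) (suc i)     ≡⟨ cong (λ y → lookup y (suc i)) (iterate-F x m) ⟩
      lookup (F (iterate F x m)) (suc i)       ≡⟨ lookup∘tabulate (local (iterate F x m)) (suc i) ⟩
      local (iterate F x m) (suc i)            ≡⟨ cong (λ b → if b then signal x m else lookup (iterate F x m) (inject₁ i)) (trans (cong (_≡ᵇ ℓ) i≡) eq) ⟩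
      signal x m                               ∎
      where open ≡-Reasoning
    ... | false = begin
      lookup (iterate F x (suc t)) (suc i)     ≡⟨ cong (λ y → lookup y (suc i)) (iterate-F x t) ⟩
      lookup (F (iterate F x t)) (suc i)       ≡⟨ lookup∘tabulate (local (iterate F x t)) (suc i) ⟩
      local (iterate F x t) (suc i)            ≡⟨ cong (λ b → if b then signal x t else lookup (iterate F x t) (inject₁ i)) (trans (cong (_≡ᵇ ℓ) i≡) eq) ⟩
      lookup (iterate F x t) (inject₁ i)       ≡⟨ go k (inject₁ i) (trans (toℕ-inject₁ i) (suc-injective i≡)) ⟩
      signal x m                               ∎
      where
      open ≡-Reasoning
      t = delay k + m

  signal-suc : ∀ x t → signal x (suc t) ≡ not (lookup (iterate F x t) leftIndex) ∨ lookup (iterate F x t) (rightIndex s)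
  signal-suc x t = trans (cong head (iterate-F x t))
    (cong₂ (λ a b → not a ∨ b) (last-xᴸ (iterate F x t)) (last-xᴿ (iterate F x t)))

  module _ {p : ℕ} where

    signal-period : ∀ {x} → HasPeriod p x → ∀ m t → signal x (m * p + t) ≡ signal x t
    signal-period x≡ m t = cong head (iterate-period F m t x≡)

    module _ .{{_ : NonZero p}} where

      signal-injective : ∀ {x y} → HasPeriod p x → HasPeriod p y →
                         (∀ t → signal x t ≡ signal y t) → x ≡ y
      signal-injective {x} {y} x≡ y≡ eq = lookup-injective x y λ i →
        trans (recover x≡ i) (trans (eq (delay (toℕ i) * p ∸ delay (toℕ i))) (sym (recover y≡ i)))
        where
        -- Node `i` shows the signal of time `- d`, represented modulo `p` by the natural number
        -- `d * p ∸ d`.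
        recover : ∀ {z} → HasPeriod p z → ∀ i →
                  lookup z i ≡ signal z (delay (toℕ i) * p ∸ delay (toℕ i))
        recover {z} z≡ i = begin
          lookup z i                               ≡⟨ cong (λ w → lookup w i) (iterate-* F d z≡) ⟨
          lookup (iterate F z (d * p)) i           ≡⟨ cong (λ t → lookup (iterate F z t) i) (m+[n∸m]≡n (m≤m*n d p)) ⟨
          lookup (iterate F z (d + (d * p ∸ d))) i ≡⟨ signal-delay z (d * p ∸ d) i ⟩
          signal z (d * p ∸ d)                     ∎
          where
          open ≡-Reasoning
          d = delay (toℕ i)

      -- Since p ∣ r, the right circuit feeds node 0 its own current value, so only the
      -- constraint of the left circuit remains.
      signal-∨ : p ∣ r → ∀ {x} → HasPeriod p x → ∀ m → signal x m ∨ signal x (ℓ + m) ≡ true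
      signal-∨ (divides q r≡qp) {x} x≡ m = absorb (u m) (u (ℓ + m)) (begin
        -- The rule is applied `s * p` steps later, so that the right end, which lags by `s`, still
        -- refers to a time in ℕ.
        u (ℓ + m)                                            ≡⟨ shift (ℓ + m) ⟨
        u (s * p + (ℓ + m))                                  ≡⟨ cong u reorder ⟩
        u (suc (l + (s * p + m)))                            ≡⟨ signal-suc x (l + (s * p + m)) ⟩
        not (lookup (X (l + (s * p + m))) leftIndex) ∨ lookup (X (l + (s * p + m))) (rightIndex s)
          ≡⟨ cong₂ (λ a b → not a ∨ b) left right ⟩
        not (u m) ∨ u (ℓ + m)                                ∎)
        where
        open ≡-Reasoning
        u = signal x
        X = iterate F x

        shift : ∀ t → u (s * p + t) ≡ u t
        shift = signal-period x≡ s

        swap : ∀ a b c → a + (b + c) ≡ b + (a + c)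
        swap = solve-∀

        reorder : s * p + (ℓ + m) ≡ ℓ + (s * p + m)
        reorder = swap (s * p) ℓ m

        left : lookup (X (l + (s * p + m))) leftIndex ≡ u m
        left = trans (cong (λ d → lookup (X (d + (s * p + m))) leftIndex) (sym delay-leftIndex))
                     (trans (signal-delay x (s * p + m) leftIndex) (shift m))

        right-time : l + (s * p + m) ≡ s + (l + (s * p ∸ s) + m)
        right-time = trans (cong (λ a → l + (a + m)) (sym (m+[n∸m]≡n (m≤m*n s p))))
          (assoc l s (s * p ∸ s) m)
          where
          assoc : ∀ l s a m → l + (s + a + m) ≡ s + (l + a + m)
          assoc = solve-∀

        right-value : r + (l + (s * p ∸ s) + m) ≡ s * p + (ℓ + m)
        right-value = trans (assoc l s (s * p ∸ s) m) (cong (_+ (ℓ + m)) (m+[n∸m]≡n (m≤m*n s p)))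
          where
          assoc : ∀ l s a m → suc s + (l + a + m) ≡ s + a + (suc l + m)
          assoc = solve-∀

        right : lookup (X (l + (s * p + m))) (rightIndex s) ≡ u (ℓ + m)
        right = begin
          lookup (X (l + (s * p + m))) (rightIndex s)
            ≡⟨ cong (λ t → lookup (X t) (rightIndex s)) right-time ⟩
          lookup (X (s + (l + (s * p ∸ s) + m))) (rightIndex s)
            ≡⟨ cong (λ d → lookup (X (d + (l + (s * p ∸ s) + m))) (rightIndex s)) (delay-rightIndex s) ⟨
          lookup (X (delay (toℕ (rightIndex s)) + (l + (s * p ∸ s) + m))) (rightIndex s)
            ≡⟨ signal-delay x _ (rightIndex s) ⟩
          -- The divisibility `p ∣ r` acts here: adding `r = q * p` steps changes nothing, and it
          -- turns the time into `ℓ + m` up to a multiple of `p`.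
          u (l + (s * p ∸ s) + m)
            ≡⟨ signal-period x≡ q _ ⟨
          u (q * p + (l + (s * p ∸ s) + m))
            ≡⟨ cong (λ a → u (a + (l + (s * p ∸ s) + m))) r≡qp ⟨
          u (r + (l + (s * p ∸ s) + m))
            ≡⟨ cong u right-value ⟩
          u (s * p + (ℓ + m))
            ≡⟨ shift (ℓ + m) ⟩
          u (ℓ + m) ∎

        absorb : ∀ a b → b ≡ not a ∨ b → a ∨ b ≡ true
        absorb true  b _  = refl
        absorb false b eq = eq

-- Cyclic words without consecutive zeros

-- The words w of length n such that prev ∷ w ∷ʳ next has no two consecutive falses.
walks : (next prev : Bool) → ∀ n → List (Vec Bool n)
walks next prev  zero    = if prev ∨ next then [] ∷ [] else []
walks next true  (suc n) = map (true ∷_) (walks next true n) ++ map (false ∷_) (walks next false n)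
walks next false (suc n) = map (true ∷_) (walks next true n)

∈-walks : ∀ {next} n (v : ℕ → Bool) → (∀ j → v j ∨ v (suc j) ≡ true) → v n ∨ next ≡ true →
          tabulate (λ (j : Fin n) → v (suc (toℕ j))) ∈ walks next (v 0) n
∈-walks zero    v v∨v last∨ rewrite last∨ = here refl
∈-walks (suc n) v v∨v last∨ with v 0 | v 1 | v∨v 0 | ∈-walks n (v ∘ suc) (v∨v ∘ suc) last∨
... | true  | true  | _ | w∈ = ∈-++⁺ˡ (∈-map⁺ (true ∷_) w∈)
... | true  | false | _ | w∈ = ∈-++⁺ʳ _ (∈-map⁺ (false ∷_) w∈)
... | false | true  | _ | w∈ = ∈-map⁺ (true ∷_) w∈

-- The first letter is also the right neighbour of the last one, so it serves as both `next` and
-- `prev` for the rest. In length 1 the letter neighbours itself and only `true` remains.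
cycles : ∀ k → List (Vec Bool (suc k))
cycles k = map (true ∷_) (walks true true k) ++ map (false ∷_) (walks false false k)

∈-cycles : ∀ k (v : ℕ → Bool) → (∀ j → v j ∨ v (suc j) ≡ true) → v (suc k) ≡ v 0 →
           tabulate (λ (j : Fin (suc k)) → v (toℕ j)) ∈ cycles k
∈-cycles k v v∨v closed
  with v 0 | ∈-walks {v 0} k v v∨v (trans (cong (v k ∨_) (sym closed)) (v∨v k))
... | true  | w∈ = ∈-++⁺ˡ (∈-map⁺ (true ∷_) w∈)
... | false | w∈ = ∈-++⁺ʳ _ (∈-map⁺ (false ∷_) w∈)

-- lucas k is the Lucas number L_{k+1}.
lucas : ℕ → ℕ
lucas k = length (cycles k)

length-walks-true : ∀ c n → length (walks c true (suc n)) ≡ length (walks c true n) + length (walks c false n)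
length-walks-true c n = trans (length-++ (map (true ∷_) (walks c true n)))
  (cong₂ _+_ (length-map _ (walks c true n)) (length-map _ (walks c false n)))

length-walks-false : ∀ c n → length (walks c false (suc n)) ≡ length (walks c true n)
length-walks-false c n = length-map _ (walks c true n)

-- Fibonacci recurrence for fixed outer letters: a `false` forces a `true` after it, so beginning
-- with `false` uses up two places.
length-walks-rec : ∀ c a n → length (walks c a (2 + n)) ≡ length (walks c a (1 + n)) + length (walks c a n)
length-walks-rec c true  n = trans (length-walks-true c (suc n))
  (cong (length (walks c true (suc n)) +_) (length-walks-false c n))
length-walks-rec c false n = trans (length-walks-false c (suc n)) (trans (length-walks-true c n)
  (cong (_+ length (walks c false n)) (sym (length-walks-false c n))))

lucas-split : ∀ k → lucas k ≡ length (walks true true k) + length (walks false false k)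
lucas-split k = trans (length-++ (map (true ∷_) (walks true true k)))
  (cong₂ _+_ (length-map _ (walks true true k)) (length-map _ (walks false false k)))

lucas-rec : ∀ k → lucas (2 + k) ≡ lucas (1 + k) + lucas k
lucas-rec k
  rewrite lucas-split (2 + k) | lucas-split (1 + k) | lucas-split k
        | length-walks-rec true true k | length-walks-rec false false k
  = shuffle (length (walks true true (1 + k))) (length (walks true true k)) _ _
  where
  shuffle : ∀ a b c d → a + b + (c + d) ≡ a + c + (b + d)
  shuffle = solve-∀

lucas-mono : ∀ k → lucas k ≤ lucas (1 + k)
lucas-mono zero    = s≤s z≤n
lucas-mono (suc k) = ≤-trans (m≤m+n (lucas (1 + k)) (lucas k)) (≤-reflexive (sym (lucas-rec k)))

lucas-growth : ∀ k → lucas (3 + k) ≤ 3 * lucas (1 + k)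
lucas-growth k = begin
  lucas (3 + k)                           ≡⟨ lucas-rec (1 + k) ⟩
  lucas (2 + k) + lucas (1 + k)           ≡⟨ cong (_+ lucas (1 + k)) (lucas-rec k) ⟩
  lucas (1 + k) + lucas k + lucas (1 + k) ≤⟨ +-monoˡ-≤ (lucas (1 + k)) (+-monoʳ-≤ (lucas (1 + k)) (lucas-mono k)) ⟩
  lucas (1 + k) + lucas (1 + k) + lucas (1 + k) ≡⟨ triple (lucas (1 + k)) ⟩
  3 * lucas (1 + k)                       ∎
  where
  open ≤-Reasoning
  triple : ∀ a → a + a + a ≡ 3 * a
  triple = solve-∀

-- Induction in steps of two: by `lucas-growth` the square gains at most a factor 9 = 3². The bases
-- are L_2² = 9 = 3² and L_3² = 16 = 27 - 11.
lucas-square-≤ : ∀ k → lucas (1 + k) * lucas (1 + k) ≤ 3 ^ (2 + k)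
lucas-square-≤ 0             = ≤-refl
lucas-square-≤ 1             = m≤m+n 16 11
lucas-square-≤ (suc (suc k)) = begin
  lucas (3 + k) * lucas (3 + k)             ≤⟨ *-mono-≤ (lucas-growth k) (lucas-growth k) ⟩
  3 * lucas (1 + k) * (3 * lucas (1 + k))   ≡⟨ nine (lucas (1 + k)) ⟩
  3 * (3 * (lucas (1 + k) * lucas (1 + k))) ≤⟨ *-monoʳ-≤ 3 (*-monoʳ-≤ 3 (lucas-square-≤ k)) ⟩
  3 ^ (4 + k)                               ∎
  where
  open ≤-Reasoning
  nine : ∀ a → 3 * a * (3 * a) ≡ 3 * (3 * (a * a))
  nine = solve-∀

^-distribʳ-* : ∀ k m n → (m * n) ^ k ≡ m ^ k * n ^ k
^-distribʳ-* zero    m n = refl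
^-distribʳ-* (suc k) m n =
  trans (cong (m * n *_) (^-distribʳ-* k m n)) (interchange m n (m ^ k) (n ^ k))
  where
  interchange : ∀ a b c d → a * b * (c * d) ≡ a * c * (b * d)
  interchange = solve-∀

-- Every residue modulo p lies on a translate, by less than gcd ℓ p, of the cycle of multiples of ℓ.
residues : ∀ ℓ p k .{{_ : NonZero p}} .{{_ : NonZero (gcd ℓ p)}} .{{_ : NonZero k}} → p ≡ k * gcd ℓ p → ∀ t →
           ∃[ i ] ∃[ j ] ∃[ c ] ∃[ d ] i < gcd ℓ p × j < k × c * p + t ≡ d * p + (i + j * ℓ)
residues ℓ p@(suc p′) k p≡ t with gcd[m,n]∣m ℓ p
... | divides a ℓ≡ = reduce (multiple (Bézout.identity (gcd-GCD ℓ p)))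
  where
  Δ = gcd ℓ p
  i = t % Δ
  m = t / Δ
  open ≡-Reasoning

  multiple : Bézout.Identity Δ ℓ p → ∃[ j ] ∃[ c ] ∃[ d ] c * p + t ≡ d * p + (i + j * ℓ)
  -- With `t = i + m * Δ`, Bézout's identity times `m` expresses `m * Δ` as a multiple of `ℓ` modulo
  -- `p`.
  multiple (Bézout.+- x y eq) = m * x , m * y , 0 , (begin
    m * y * p + t           ≡⟨ cong (m * y * p +_) (m≡m%n+[m/n]*n t Δ) ⟩
    m * y * p + (i + m * Δ) ≡⟨ factor m y p i Δ ⟩
    i + m * (Δ + y * p)     ≡⟨ cong (λ z → i + m * z) eq ⟩
    i + m * (x * ℓ)         ≡⟨ cong (i +_) (sym (*-assoc m x ℓ)) ⟩
    i + m * x * ℓ           ∎)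
    where
    factor : ∀ m y p i Δ → m * y * p + (i + m * Δ) ≡ i + m * (Δ + y * p)
    factor = solve-∀
  -- Here `Δ` is `- x * ℓ` modulo `p`; the factor `p′ = p - 1` stands in for `- 1`.
  multiple (Bézout.-+ x y eq) = m * x * p′ , m * x * ℓ , m * y , (begin
    m * x * ℓ * p + t                      ≡⟨ cong (m * x * ℓ * p +_) (m≡m%n+[m/n]*n t Δ) ⟩
    m * x * ℓ * p + (i + m * Δ)            ≡⟨ factor m x ℓ p′ i Δ ⟩
    m * (Δ + x * ℓ) + (i + m * x * p′ * ℓ) ≡⟨ cong (λ z → m * z + (i + m * x * p′ * ℓ)) eq ⟩
    m * (y * p) + (i + m * x * p′ * ℓ)     ≡⟨ cong (_+ (i + m * x * p′ * ℓ)) (sym (*-assoc m y p)) ⟩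
    m * y * p + (i + m * x * p′ * ℓ)       ∎)
    where
    factor : ∀ m x ℓ p′ i Δ → m * x * ℓ * suc p′ + (i + m * Δ) ≡ m * (Δ + x * ℓ) + (i + m * x * p′ * ℓ)
    factor = solve-∀

  -- Going `k` times by `ℓ` returns to the start modulo `p`, so `j` matters only modulo `k`.
  kℓ≡ap : k * ℓ ≡ a * p
  kℓ≡ap = begin
    k * ℓ       ≡⟨ cong (k *_) ℓ≡ ⟩
    k * (a * Δ) ≡⟨ swap k a Δ ⟩
    a * (k * Δ) ≡⟨ cong (a *_) p≡ ⟨
    a * p       ∎
    where
    swap : ∀ k a Δ → k * (a * Δ) ≡ a * (k * Δ)
    swap = solve-∀

  reduce : (∃[ j ] ∃[ c ] ∃[ d ] c * p + t ≡ d * p + (i + j * ℓ)) →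
           ∃[ i ] ∃[ j ] ∃[ c ] ∃[ d ] i < Δ × j < k × c * p + t ≡ d * p + (i + j * ℓ)
  reduce (j , c , d , eq) = i , j % k , c , d + e * a , m%n<n t Δ , m%n<n j k , (begin
    c * p + t                             ≡⟨ eq ⟩
    d * p + (i + j * ℓ)                   ≡⟨ cong (λ z → d * p + (i + z * ℓ)) (m≡m%n+[m/n]*n j k) ⟩
    d * p + (i + (j % k + e * k) * ℓ)     ≡⟨ expand d p i (j % k) e k ℓ ⟩
    d * p + e * (k * ℓ) + (i + j % k * ℓ) ≡⟨ cong (λ z → d * p + e * z + (i + j % k * ℓ)) kℓ≡ap ⟩
    d * p + e * (a * p) + (i + j % k * ℓ) ≡⟨ collect d p e a (i + j % k * ℓ) ⟩
    (d + e * a) * p + (i + j % k * ℓ)     ∎)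
    where
    e = j / k
    expand : ∀ d p i j e k ℓ → d * p + (i + (j + e * k) * ℓ) ≡ d * p + e * (k * ℓ) + (i + j * ℓ)
    expand = solve-∀
    collect : ∀ d p e a b → d * p + e * (a * p) + b ≡ (d + e * a) * p + b
    collect = solve-∀

-- Encoding of periodic configurations by families of cyclic words

module _ (l s : ℕ) {p : ℕ} .{{p≢0 : NonZero p}} where
  open Circuit l s
  open Dynamics l s

  private Δ = gcd ℓ p

  -- Row `i` reads the signal along the cycle of `i` under translation by `ℓ`. Times are left
  -- unreduced modulo `p`, as the signal is defined at all of them.
  encode : ∀ k → Config n → Vec (Vec Bool k) Δ
  encode k x = tabulate λ i → tabulate λ j → signal x (toℕ i + toℕ j * ℓ)

  lookup-encode : ∀ {k} x i j → lookup (lookup (encode k x) i) j ≡ signal x (toℕ i + toℕ j * ℓ)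
  lookup-encode {k} x i j = trans
    (cong (λ v → lookup v j) (lookup∘tabulate (λ i → tabulate λ j → signal x (toℕ i + toℕ j * ℓ)) i))
    (lookup∘tabulate (λ j → signal x (toℕ i + toℕ j * ℓ)) j)

  encode-injective : ∀ {k x y} .{{_ : NonZero k}} .{{_ : NonZero Δ}} → p ≡ k * Δ →
                     HasPeriod p x → HasPeriod p y → encode k x ≡ encode k y → x ≡ y
  encode-injective {k} {x} {y} p≡ x≡ y≡ eq = signal-injective x≡ y≡ same
    where
    open ≡-Reasoning
    same : ∀ t → signal x t ≡ signal y t
    same t with residues ℓ p k p≡ t
    ... | i , j , c , d , i<Δ , j<k , t≡ = begin
      signal x t           ≡⟨ move x≡ ⟩
      signal x (i + j * ℓ) ≡⟨ read x ⟨
      entry x              ≡⟨ cong (λ v → lookup (lookup v (fromℕ< i<Δ)) (fromℕ< j<k)) eq ⟩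
      entry y              ≡⟨ read y ⟩
      signal y (i + j * ℓ) ≡⟨ move y≡ ⟨
      signal y t           ∎
      where
      move : ∀ {z} → HasPeriod p z → signal z t ≡ signal z (i + j * ℓ)
      move {z} z≡ = trans (sym (signal-period z≡ c t))
        (trans (cong (signal z) t≡) (signal-period z≡ d (i + j * ℓ)))

      entry : Config n → Bool
      entry z = lookup (lookup (encode k z) (fromℕ< i<Δ)) (fromℕ< j<k)

      read : ∀ z → entry z ≡ signal z (i + j * ℓ)
      read z = trans (lookup-encode z (fromℕ< i<Δ) (fromℕ< j<k))
        (cong₂ (λ i j → signal z (i + j * ℓ)) (toℕ-fromℕ< i<Δ) (toℕ-fromℕ< j<k))

  encode-∈ : ∀ {k x} → p ∣ r → p ≡ suc k * Δ → HasPeriod p x →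
             encode (suc k) x ∈ vectors Δ (cycles k)
  encode-∈ {k} {x} p∣r p≡ x≡ with gcd[m,n]∣m ℓ p
  ... | divides a ℓ≡ = ∈-vectors (tabulate⁺ λ i → ∈-cycles k (v (toℕ i)) (step (toℕ i)) (closed (toℕ i)))
    where
    v : ℕ → ℕ → Bool
    v i j = signal x (i + j * ℓ)

    swap : ∀ i j ℓ → ℓ + (i + j) ≡ i + (ℓ + j)
    swap = solve-∀

    step : ∀ i j → v i j ∨ v i (suc j) ≡ true
    step i j = trans (cong (λ t → v i j ∨ signal x t) (sym (swap i (j * ℓ) ℓ)))
      (signal-∨ p∣r x≡ (i + j * ℓ))

    -- `suc k * ℓ` is a multiple of `suc k * Δ = p`, so the row closes up.
    closed : ∀ i → v i (suc k) ≡ v i 0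
    closed i = trans (cong (signal x) time) (signal-period x≡ a (i + 0))
      where
      open ≡-Reasoning
      regroup : ∀ i a k Δ → i + k * (a * Δ) ≡ a * (k * Δ) + (i + 0)
      regroup = solve-∀
      time : i + suc k * ℓ ≡ a * p + (i + 0)
      time = begin
        i + suc k * ℓ             ≡⟨ cong (λ z → i + suc k * z) ℓ≡ ⟩
        i + suc k * (a * Δ)       ≡⟨ regroup i a (suc k) Δ ⟩
        a * (suc k * Δ) + (i + 0) ≡⟨ cong (λ z → a * z + (i + 0)) p≡ ⟨
        a * p + (i + 0)           ∎

  -- There are `Δ` rows of length `p / Δ`, each one of the words in `cycles`. This quotient is not
  -- 1, since then `p = gcd ℓ p` would divide `ℓ`.
  attractors-square-≤ : p ∣ r → ¬ p ∣ ℓ → let N = length (attractors p) * p in N * N ≤ 3 ^ p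
  attractors-square-≤ p∣r p∤ℓ with gcd[m,n]∣n ℓ p
  ... | divides 0 p≡ = ⊥-elim (≢-nonZero⁻¹ p p≡)
  ... | divides 1 p≡ = ⊥-elim (p∤ℓ (subst (_∣ ℓ) (sym (trans p≡ (*-identityˡ Δ))) (gcd[m,n]∣m ℓ p)))
  ... | divides (suc (suc k)) p≡ = begin
    N * N                                 ≤⟨ *-mono-≤ bound bound ⟩
    lucas (1 + k) ^ Δ * lucas (1 + k) ^ Δ ≡⟨ ^-distribʳ-* Δ (lucas (1 + k)) (lucas (1 + k)) ⟨
    (lucas (1 + k) * lucas (1 + k)) ^ Δ   ≤⟨ ^-monoˡ-≤ Δ (lucas-square-≤ k) ⟩
    (3 ^ (2 + k)) ^ Δ                     ≡⟨ ^-*-assoc 3 (2 + k) Δ ⟩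
    3 ^ ((2 + k) * Δ)                     ≡⟨ cong (3 ^_) p≡ ⟨
    3 ^ p                                 ∎
    where
    open ≤-Reasoning
    N = length (attractors p) * p
    instance
      Δ≢0 : NonZero Δ
      Δ≢0 = ≢-nonZero λ Δ≡0 → ≢-nonZero⁻¹ p (trans p≡ (trans (cong ((2 + k) *_) Δ≡0) (*-zeroʳ k)))
    bound : N ≤ lucas (1 + k) ^ Δ
    bound = ≤-trans
      (attractors-bound l s (encode (2 + k)) (encode-∈ p∣r p≡) (encode-injective p≡))
      (≤-reflexive (length-vectors Δ (cycles (1 + k))))

-- The Möbius sum

∣-1^k∣ : ∀ k → ∣ -1ℤ ℤ.^ k ∣ ≡ 1
∣-1^k∣ zero    = refl
∣-1^k∣ (suc k) = trans (ℤ.abs-* -1ℤ (-1ℤ ℤ.^ k)) (trans (*-identityˡ _) (∣-1^k∣ k))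

∣μ∣≤1 : ∀ m → ∣ μ m ∣ ≤ 1
∣μ∣≤1 zero = z≤n
∣μ∣≤1 (suc m) = go (does (DecUnique.unique? _≟_ primes)) (length primes)
  where
  primes = PrimeFactorisation.factors (factorise (suc m))
  go : ∀ b k → ∣ if b then -1ℤ ℤ.^ k else 0ℤ ∣ ≤ 1
  go true  k = ≤-reflexive (∣-1^k∣ k)
  go false k = z≤n

0≤i+k : ∀ {i k} → ∣ i ∣ ≤ k → 0ℤ ℤ.≤ i ℤ.+ ℤ.+ k
0≤i+k {ℤ.+ _}      _   = ℤ.+≤+ z≤n
0≤i+k { -[1+ n ]} n<k rewrite ℤ.⊖-≥ n<k = ℤ.+≤+ z≤n

-- A negative `i` would give `a ≤ b`. This replaces the integer `möbiusSum` by a natural number.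
natural-summand : ∀ i {a b} → b < a → ℤ.+ a ℤ.≤ i ℤ.+ ℤ.+ b → ∃ λ m → i ≡ ℤ.+ m × a ≤ m + b
natural-summand (ℤ.+ m)  b<a a≤ = m , refl , ℤ.drop‿+≤+ a≤
natural-summand -[1+ m ] b<a a≤ =
  ⊥-elim (<⇒≱ b<a (ℤ.drop‿+≤+ (ℤ.≤-trans a≤ (ℤ.m⊖n≤m _ (suc m)))))

module _ (p : ℕ) where

  divisors : ℕ → List ℕ
  divisors m = filter (λ i → suc i ∣? p) (upTo m)

  term : ℕ → ℤ
  term i = μ (p / suc i) ℤ.* ℤ.+ (2 ^ suc i)

  signedSum : List ℕ → ℤ
  signedSum is = foldr ℤ._+_ 0ℤ (map term is)

  powerSum : List ℕ → ℕ
  powerSum is = sum (map (λ i → 2 ^ suc i) is)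

  divisors-suc : ∀ m → divisors (suc m) ≡ divisors m ++ filter (λ i → suc i ∣? p) (m ∷ [])
  divisors-suc m = trans (cong (filter (λ i → suc i ∣? p)) (sym (upTo-∷ʳ m)))
    (filter-++ (λ i → suc i ∣? p) (upTo m) (m ∷ []))

  divisors-suc-yes : ∀ {m} → suc m ∣ p → divisors (suc m) ≡ divisors m ++ m ∷ []
  divisors-suc-yes {m} m∣p =
    trans (divisors-suc m) (cong (divisors m ++_) (filter-accept (λ i → suc i ∣? p) m∣p))

  divisors-suc-no : ∀ {m} → ¬ suc m ∣ p → divisors (suc m) ≡ divisors m
  divisors-suc-no {m} m∤p =
    trans (divisors-suc m) (trans (cong (divisors m ++_) (filter-reject (λ i → suc i ∣? p) m∤p)) (++-identityʳ _))

  powerSum-∷ʳ : ∀ is i → powerSum (is ++ i ∷ []) ≡ powerSum is + 2 ^ suc i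
  powerSum-∷ʳ is i = trans (cong sum (map-++ _ is (i ∷ [])))
    (trans (sum-++ (map (λ i → 2 ^ suc i) is) _) (cong (λ z → powerSum is + z) (+-identityʳ (2 ^ suc i))))

  -- The right side is the full geometric sum 2 + 4 + ... + 2ᵐ, plus 2; moving the 2 to the left
  -- avoids subtraction.
  powerSum-divisors-crude : ∀ m → powerSum (divisors m) + 2 ≤ 2 ^ suc m
  powerSum-divisors-crude zero = ≤-refl
  powerSum-divisors-crude (suc m) with suc m ∣? p
  ... | no  m∤p rewrite divisors-suc-no m∤p =
    ≤-trans (powerSum-divisors-crude m) (m≤m+n (2 ^ suc m) _)
  ... | yes m∣p rewrite divisors-suc-yes m∣p | powerSum-∷ʳ (divisors m) m = begin
    powerSum (divisors m) + 2 ^ suc m + 2   ≡⟨ +-assoc (powerSum (divisors m)) _ _ ⟩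
    powerSum (divisors m) + (2 ^ suc m + 2) ≡⟨ cong (powerSum (divisors m) +_) (+-comm (2 ^ suc m) 2) ⟩
    powerSum (divisors m) + (2 + 2 ^ suc m) ≡⟨ +-assoc (powerSum (divisors m)) 2 _ ⟨
    powerSum (divisors m) + 2 + 2 ^ suc m   ≤⟨ +-monoˡ-≤ (2 ^ suc m) (powerSum-divisors-crude m) ⟩
    2 ^ suc m + 2 ^ suc m                   ≡⟨ cong (λ z → 2 ^ suc m + z) (+-identityʳ (2 ^ suc m)) ⟨
    2 ^ suc (suc m)                         ∎
    where open ≤-Reasoning

  -- Non-divisors are dropped from the top until the largest divisor appears; it is at most `h`, and
  -- the geometric sum up to it suffices.
  powerSum-divisors : ∀ {h} m → (∀ {i} → i < m → suc i ∣ p → suc i ≤ h) →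
                      powerSum (divisors m) + 2 ≤ 2 ^ suc h
  powerSum-divisors {h} zero    small = *-monoʳ-≤ 2 (m^n>0 2 h)
  powerSum-divisors {h} (suc m) small with suc m ∣? p
  ... | no  m∤p rewrite divisors-suc-no m∤p =
    powerSum-divisors m (λ i<m → small (m<n⇒m<1+n i<m))
  ... | yes m∣p = ≤-trans (powerSum-divisors-crude (suc m)) (^-monoʳ-≤ 2 (s≤s (small ≤-refl m∣p)))

  term-bound : ∀ i → ∣ term i ∣ ≤ 2 ^ suc i
  term-bound i = begin
    ∣ term i ∣                                 ≡⟨ ℤ.abs-* (μ (p / suc i)) _ ⟩
    ∣ μ (p / suc i) ∣ * 2 ^ suc i              ≤⟨ *-monoˡ-≤ (2 ^ suc i) (∣μ∣≤1 (p / suc i)) ⟩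
    1 * 2 ^ suc i                              ≡⟨ *-identityˡ _ ⟩
    2 ^ suc i                                  ∎
    where open ≤-Reasoning


  -- As μ is at most 1 in absolute value, omitting the term of `i` raises the sum by at most
  -- `2 ^ suc i`. It is used to keep only the term of `p` itself.
  signedSum-++ : ∀ is js → signedSum js ℤ.≤ signedSum (is ++ js) ℤ.+ ℤ.+ powerSum is
  signedSum-++ [] js = ℤ.≤-reflexive (sym (ℤ.+-identityʳ _))
  signedSum-++ (i ∷ is) js = begin
    signedSum js                                                              ≤⟨ signedSum-++ is js ⟩
    signedSum (is ++ js) ℤ.+ ℤ.+ powerSum is                                    ≡⟨ ℤ.+-identityˡ _ ⟨
    0ℤ ℤ.+ (signedSum (is ++ js) ℤ.+ ℤ.+ powerSum is)                           ≤⟨ ℤ.+-monoˡ-≤ (signedSum (is ++ js) ℤ.+ ℤ.+ powerSum is) (0≤i+k {term i} (term-bound i)) ⟩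
    term i ℤ.+ ℤ.+ (2 ^ suc i) ℤ.+ (signedSum (is ++ js) ℤ.+ ℤ.+ powerSum is)     ≡⟨ interchange (term i) _ _ _ ⟩
    term i ℤ.+ signedSum (is ++ js) ℤ.+ (ℤ.+ (2 ^ suc i) ℤ.+ ℤ.+ powerSum is)     ≡⟨⟩
    signedSum (i ∷ is ++ js) ℤ.+ ℤ.+ powerSum (i ∷ is)                          ∎
    where
    open ℤ.≤-Reasoning
    interchange : ∀ a b c d → a ℤ.+ b ℤ.+ (c ℤ.+ d) ≡ a ℤ.+ c ℤ.+ (b ℤ.+ d)
    interchange a b c d = trans (ℤ.+-assoc a b _) (trans (cong (λ z → a ℤ.+ z)
      (trans (sym (ℤ.+-assoc b c d)) (trans (cong (ℤ._+ d) (ℤ.+-comm b c)) (ℤ.+-assoc c b d)))) (sym (ℤ.+-assoc a c _)))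

proper-divisor-≤half : ∀ {d p} → d ∣ p → d < p → d ≤ ⌊ p /2⌋
proper-divisor-≤half (divides 0 refl) ()
proper-divisor-≤half {d} (divides 1 refl) d<p = ⊥-elim (<-irrefl (sym (*-identityˡ d)) d<p)
proper-divisor-≤half {d} (divides (suc (suc q)) refl) _ = ≤-trans (≤-reflexive (n≡⌊n+n/2⌋ d))
  (⌊n/2⌋-mono (≤-trans (m≤m+n (d + d) (q * d)) (≤-reflexive (+-assoc d d (q * d)))))

-- Here `p ≥ 3` is essential: there is equality at 3 and 4, and 2 would give 3 ≤ 2.
half+2≤ : ∀ q → 2 + ⌊ 3 + q /2⌋ ≤ 3 + q
half+2≤ zero          = ≤-refl
half+2≤ (suc zero)    = ≤-refl
half+2≤ (suc (suc q)) = s≤s (≤-trans (half+2≤ q) (n≤1+n _))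

-- The divisor `p` contributes μ(1) 2ᵖ = 2ᵖ, and the proper divisors, all at most p/2, together
-- remove less than half of it.
möbiusSum-bound : ∀ p → 3 ≤ p → ∃ λ M → möbiusSum p ≡ ℤ.+ M × 2 ^ p < 2 * M
möbiusSum-bound 1                   (s≤s ())
möbiusSum-bound 2                   (s≤s (s≤s ()))
möbiusSum-bound (suc (suc (suc q))) _ = let M , M≡ , 2^p≤M+S = natural in M , M≡ , 2^p<2M M 2^p≤M+S
  where
  p = 3 + q
  S = powerSum p (divisors p (2 + q))

  μ-top : term p (2 + q) ≡ ℤ.+ (2 ^ p)
  μ-top = trans (cong (λ m → μ m ℤ.* ℤ.+ (2 ^ p)) (n/n≡1 p)) (ℤ.*-identityˡ _)

  lower : ℤ.+ (2 ^ p) ℤ.≤ möbiusSum p ℤ.+ ℤ.+ S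
  lower = begin
    ℤ.+ (2 ^ p)                                               ≡⟨ trans (ℤ.+-identityʳ _) μ-top ⟨
    signedSum p (2 + q ∷ [])                                ≤⟨ signedSum-++ p (divisors p (2 + q)) (2 + q ∷ []) ⟩
    signedSum p (divisors p (2 + q) ++ 2 + q ∷ []) ℤ.+ ℤ.+ S  ≡⟨ cong (λ is → signedSum p is ℤ.+ ℤ.+ S) (divisors-suc-yes p ∣-refl) ⟨
    möbiusSum p ℤ.+ ℤ.+ S                                     ∎
    where open ℤ.≤-Reasoning

  S<2^[p-1] : S < 2 ^ (2 + q)
  S<2^[p-1] = <-≤-trans (m<m+n S (s≤s z≤n)) (≤-trans
    (powerSum-divisors p (2 + q) (λ i<q d∣p → proper-divisor-≤half d∣p (s≤s i<q)))
    (^-monoʳ-≤ 2 (s≤s⁻¹ (half+2≤ q))))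

  natural : ∃ λ M → möbiusSum p ≡ ℤ.+ M × 2 ^ p ≤ M + S
  natural = natural-summand (möbiusSum p) (<-≤-trans S<2^[p-1] (m≤m+n _ _)) lower

  2^p<2M : ∀ M → 2 ^ p ≤ M + S → 2 ^ p < 2 * M
  2^p<2M M 2^p≤M+S = +-cancelʳ-< (2 ^ p) (2 ^ p) (2 * M) (begin-strict
    2 ^ p + 2 ^ p         ≡⟨ cong (2 ^ p +_) (+-identityʳ (2 ^ p)) ⟨
    2 * 2 ^ p             ≤⟨ *-monoʳ-≤ 2 2^p≤M+S ⟩
    2 * (M + S)           ≡⟨ *-distribˡ-+ 2 M S ⟩
    2 * M + 2 * S         <⟨ +-monoʳ-< (2 * M) (*-monoʳ-< 2 S<2^[p-1]) ⟩
    2 * M + 2 * 2 ^ (2 + q) ∎)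
    where open ≤-Reasoning

-- The order of ℚ(√3)

infix 8 _÷_
_÷_ : ℕ → (d : ℕ) .{{_ : NonZero d}} → ℚ
a ÷ d = ℤ.+ a ℚ./ d

-- `ℚ./` reduces to lowest terms, so the product is taken among unnormalised fractions, where
-- numerators and denominators simply multiply.
÷-* : ∀ a b c d .{{_ : NonZero b}} .{{_ : NonZero d}} → a ÷ b ℚ.* c ÷ d ≡ _÷_ (a * c) (b * d) {{m*n≢0 b d}}
÷-* a b@(suc b-1) c d@(suc d-1) = ℚ.toℚᵘ-injective (begin
  toℚᵘ (a ÷ b ℚ.* c ÷ d)                     ≈⟨ ℚ.toℚᵘ-homo-* (a ÷ b) (c ÷ d) ⟩
  toℚᵘ (a ÷ b) ℚᵘ.* toℚᵘ (c ÷ d)             ≈⟨ ℚᵘ.*-cong (ℚ.toℚᵘ-fromℚᵘ (mkℚᵘ (ℤ.+ a) b-1)) (ℚ.toℚᵘ-fromℚᵘ (mkℚᵘ (ℤ.+ c) d-1)) ⟩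
  mkℚᵘ (ℤ.+ a) b-1 ℚᵘ.* mkℚᵘ (ℤ.+ c) d-1     ≡⟨ cong (λ z → mkℚᵘ z _) (ℤ.pos-* a c) ⟨
  mkℚᵘ (ℤ.+ (a * c)) (d-1 + b-1 * d)         ≈⟨ ℚ.toℚᵘ-fromℚᵘ _ ⟨
  toℚᵘ (_÷_ (a * c) (b * d) {{m*n≢0 b d}})   ∎)
  where open import Relation.Binary.Reasoning.Setoid ℚᵘ.≃-setoid

÷-< : ∀ {a b c d} .{{_ : NonZero b}} .{{_ : NonZero d}} → a * d < c * b → a ÷ b ℚ.< c ÷ d
÷-< {a} {b@(suc b-1)} {c} {d@(suc d-1)} ad<cb = ℚ.toℚᵘ-cancel-<
  (ℚᵘ.<-respˡ-≃ (ℚᵘ.≃-sym (ℚ.toℚᵘ-fromℚᵘ (mkℚᵘ (ℤ.+ a) b-1)))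
    (ℚᵘ.<-respʳ-≃ (ℚᵘ.≃-sym (ℚ.toℚᵘ-fromℚᵘ (mkℚᵘ (ℤ.+ c) d-1)))
      (ℚᵘ.*<* (subst₂ ℤ._<_ (ℤ.pos-* a d) (ℤ.pos-* c b) (ℤ.+<+ ad<cb)))))

0<b-a : ∀ {a b} → a ℚ.< b → 0ℚ ℚ.< b ℚ.- a
0<b-a {a} {b} a<b = subst (ℚ._< b ℚ.- a) (ℚ.+-inverseʳ a) (ℚ.+-monoˡ-< (ℚ.- a) a<b)

3^k/4^k : ℕ → ℚ
3^k/4^k k = _÷_ (3 ^ k) (4 ^ k) {{m^n≢0 4 k}}

module _ where
  open ℚ-Solver.+-*-Solver

  -- Multiplication by `√3/2` exchanges the two components, which is why the powers alternate
  -- between rational and purely irrational.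
  √3/2-* : ∀ a b → √3/2 *√ (a +√3· b) ≡ (3ℚ ℚ.* (½ ℚ.* b)) +√3· (½ ℚ.* a)
  √3/2-* a b = cong₂ _+√3·_
    (solve 2 (λ a b → con 0ℚ :* a :+ con 3ℚ :* (con ½ :* b) := con 3ℚ :* (con ½ :* b)) refl a b)
    (solve 2 (λ a b → con 0ℚ :* b :+ con ½ :* a := con ½ :* a) refl a b)

  fromℚ-*-fromℚ : ∀ c a b d → fromℚ c *√ (a +√3· b) *√ fromℚ d ≡ (c ℚ.* a ℚ.* d) +√3· (c ℚ.* b ℚ.* d)
  fromℚ-*-fromℚ c a b d = cong₂ _+√3·_
    (solve 4 (λ c a b d → (c :* a :+ con 3ℚ :* (con 0ℚ :* b)) :* d :+ con 3ℚ :* ((c :* b :+ con 0ℚ :* a) :* con 0ℚ)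
                        := c :* a :* d) refl c a b d)
    (solve 4 (λ c a b d → (c :* a :+ con 3ℚ :* (con 0ℚ :* b)) :* con 0ℚ :+ (c :* b :+ con 0ℚ :* a) :* d
                        := c :* b :* d) refl c a b d)

  ¾-assoc : ∀ v → 3ℚ ℚ.* (½ ℚ.* (½ ℚ.* v)) ≡ 3 ÷ 4 ℚ.* v
  ¾-assoc = solve 1 (λ v → con 3ℚ :* (con ½ :* (con ½ :* v)) := con (3 ÷ 4) :* v) refl

√3/2-even : ∀ k → √3/2 ^√ (k + k) ≡ 3^k/4^k k +√3· 0ℚ
√3/2-odd  : ∀ k → √3/2 ^√ suc (k + k) ≡ 0ℚ +√3· (½ ℚ.* 3^k/4^k k)

√3/2-even zero    = refl
√3/2-even (suc k) = begin
  √3/2 *√ √3/2 ^√ (k + suc k)                    ≡⟨ cong (λ m → √3/2 *√ √3/2 ^√ m) (+-suc k k) ⟩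
  √3/2 *√ √3/2 ^√ suc (k + k)                    ≡⟨ cong (√3/2 *√_) (√3/2-odd k) ⟩
  √3/2 *√ (0ℚ +√3· (½ ℚ.* v))                    ≡⟨ √3/2-* 0ℚ (½ ℚ.* v) ⟩
  (3ℚ ℚ.* (½ ℚ.* (½ ℚ.* v))) +√3· 0ℚ             ≡⟨ cong (_+√3· 0ℚ) (¾-assoc v) ⟩
  (3 ÷ 4 ℚ.* v) +√3· 0ℚ                          ≡⟨ cong (_+√3· 0ℚ) (÷-* 3 4 (3 ^ k) (4 ^ k) {{it}} {{m^n≢0 4 k}}) ⟩
  3^k/4^k (suc k) +√3· 0ℚ                        ∎
  where
  open ≡-Reasoning
  v = 3^k/4^k k

√3/2-odd k = trans (cong (√3/2 *√_) (√3/2-even k)) (√3/2-* (3^k/4^k k) 0ℚ)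

halve : ∀ p → ∃ λ k → p ≡ k + k ⊎ p ≡ suc (k + k)
halve zero    = 0 , inj₁ refl
halve (suc p) with halve p
... | k , inj₁ p≡ = k , inj₂ (cong suc p≡)
... | k , inj₂ p≡ = suc k , inj₁ (cong suc (trans p≡ (sym (+-suc k k))))

*-cancel-square-≤ : ∀ {m n} → m * m ≤ n * n → m ≤ n
*-cancel-square-≤ {m} {n} m²≤n² = ≮⇒≥ λ n<m → <⇒≱ (*-mono-< n<m n<m) m²≤n²

2^[k+k] : ∀ k → 2 ^ (k + k) ≡ 4 ^ k
2^[k+k] k = trans (cong (2 ^_) (cong (k +_) (sym (+-identityʳ k)))) (sym (^-*-assoc 2 2 k))

positive-rational : ∀ {a b i} → a ℚ.< b → i ≡ 0ℚ → Positive ((b ℚ.- a) +√3· i)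
positive-rational a<b refl = pos-pos (ℚ.<⇒≤ (0<b-a a<b)) ℚ.≤-refl
  (subst (0ℚ ℚ.<_) (sym (ℚ.+-identityʳ _)) (0<b-a a<b))

-- The number is `N/D` times √3, minus `a`. For `a = 0` it falls under `pos-pos`, otherwise under
-- `neg-pos`, whose comparison of squares is the hypothesis cleared of denominators.
positive-irrational : ∀ {a N D r i} .{{_ : NonZero D}} → 0 < N → a * a * (1 * (D * D)) < 3 * (N * N) * 1 →
               r ≡ ℚ.- (a ÷ 1) → i ≡ N ÷ D → Positive (r +√3· i)
positive-irrational {zero} {N} {D} 0<N _ refl refl =
  pos-pos ℚ.≤-refl (ℚ.<⇒≤ 0<i) (subst (0ℚ ℚ.<_) (sym (ℚ.+-identityˡ _)) 0<i)
  where
  0<i : 0ℚ ℚ.< N ÷ D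
  0<i = ÷-< {0} {1} {N} {D} (≤-trans 0<N (≤-reflexive (sym (*-identityʳ N))))
positive-irrational {a@(suc _)} {N} {D} 0<N a²<3i² refl refl = neg-pos
  (ℚ.neg-antimono-< (÷-< {0} {1} {a} {1} (s≤s z≤n)))
  (÷-< {0} {1} {N} {D} (≤-trans 0<N (≤-reflexive (sym (*-identityʳ N)))))
  (subst₂ ℚ._<_ (sym square) (sym triple) (÷-< {a * a} {1} {3 * (N * N)} {1 * (D * D)} {{_}} {{D²≢0}} a²<3i²))
  where
  D²≢0 : NonZero (1 * (D * D))
  D²≢0 = m*n≢0 1 (D * D) {{_}} {{m*n≢0 D D}}
  square : ℚ.- (a ÷ 1) ℚ.* ℚ.- (a ÷ 1) ≡ (a * a) ÷ 1
  square = trans (neg² (a ÷ 1)) (÷-* a 1 a 1)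
    where
    open ℚ-Solver.+-*-Solver
    neg² : ∀ x → ℚ.- x ℚ.* ℚ.- x ≡ x ℚ.* x
    neg² = solve 1 (λ x → (:- x) :* (:- x) := x :* x) refl
  triple : 3ℚ ℚ.* (N ÷ D ℚ.* N ÷ D) ≡ _÷_ (3 * (N * N)) (1 * (D * D)) {{D²≢0}}
  triple = trans (cong (3ℚ ℚ.*_) (÷-* N D N D)) (÷-* 3 1 (N * N) (D * D) {{_}} {{m*n≢0 D D}})

-- The factors 1 are those left by multiplying out fractions with ÷-*.
module _ (A M p : ℕ) .{{p≢0 : NonZero p}} (A² : A * p * (A * p) ≤ 3 ^ p) (2^p<2M : 2 ^ p < 2 * M) where

  -- For `p = k + k` the square root can be taken in ℕ: `A * p ≤ 3 ^ k`.
  even-bound : ∀ k → p ≡ k + k → A * (1 * 4 ^ k * p) < 2 * 3 ^ k * M * 1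
  even-bound k p≡ = begin-strict
    A * (1 * 4 ^ k * p)   ≡⟨ arrange A (4 ^ k) p ⟩
    A * p * 4 ^ k         ≤⟨ *-monoˡ-≤ (4 ^ k) (*-cancel-square-≤ {A * p} {3 ^ k} Ap²) ⟩
    3 ^ k * 4 ^ k         <⟨ *-monoʳ-< (3 ^ k) {{m^n≢0 3 k}} (subst (_< 2 * M) (trans (cong (2 ^_) p≡) (2^[k+k] k)) 2^p<2M) ⟩
    3 ^ k * (2 * M)       ≡⟨ arrange′ (3 ^ k) M ⟩
    2 * 3 ^ k * M * 1     ∎
    where
    open ≤-Reasoning
    Ap² : A * p * (A * p) ≤ 3 ^ k * 3 ^ k
    Ap² = ≤-trans A² (≤-reflexive (trans (cong (3 ^_) p≡) (^-distribˡ-+-* 3 k k)))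
    arrange : ∀ a f p → a * (1 * f * p) ≡ a * p * f
    arrange = solve-∀
    arrange′ : ∀ t m → t * (2 * m) ≡ 2 * t * m * 1
    arrange′ = solve-∀

  -- For odd `p` the root of `3 ^ p` is irrational, so the comparison stays squared; the unpaired
  -- factor 3 becomes the 3 demanded by `neg-pos`.
  odd-bound : ∀ k → p ≡ suc (k + k) →
              let N = 2 * (1 * 3 ^ k) * M; D = 1 * (2 * 4 ^ k) * p in
              A * A * (1 * (D * D)) < 3 * (N * N) * 1
  odd-bound k p≡ = begin-strict
    A * A * (1 * (D * D))                                     ≡⟨ arrange A (4 ^ k) p ⟩
    A * p * (A * p) * (2 * 4 ^ k * (2 * 4 ^ k))               ≤⟨ *-monoˡ-≤ _ A² ⟩
    3 ^ p * (2 * 4 ^ k * (2 * 4 ^ k))                         <⟨ *-monoʳ-< (3 ^ p) {{m^n≢0 3 p}} (*-mono-< 2·4^k<2M 2·4^k<2M) ⟩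
    3 ^ p * (2 * M * (2 * M))                                 ≡⟨ cong (_* (2 * M * (2 * M))) 3^p ⟩
    3 * (3 ^ k * 3 ^ k) * (2 * M * (2 * M))                   ≡⟨ arrange′ (3 ^ k) M ⟩
    3 * (N * N) * 1                                           ∎
    where
    open ≤-Reasoning
    N = 2 * (1 * 3 ^ k) * M
    D = 1 * (2 * 4 ^ k) * p
    2·4^k<2M : 2 * 4 ^ k < 2 * M
    2·4^k<2M = subst (_< 2 * M) (trans (cong (2 ^_) p≡) (cong (2 *_) (2^[k+k] k))) 2^p<2M
    3^p : 3 ^ p ≡ 3 * (3 ^ k * 3 ^ k)
    3^p = trans (cong (3 ^_) p≡) (cong (3 *_) (^-distribˡ-+-* 3 k k))
    arrange : ∀ a f p → a * a * (1 * (1 * (2 * f) * p * (1 * (2 * f) * p))) ≡ a * p * (a * p) * (2 * f * (2 * f))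
    arrange = solve-∀
    arrange′ : ∀ t m → 3 * (t * t) * (2 * m * (2 * m)) ≡ 3 * (2 * (1 * t) * m * (2 * (1 * t) * m)) * 1
    arrange′ = solve-∀

  private
    product : ∀ a b .{{_ : NonZero b}} → 2 ÷ 1 ℚ.* a ÷ b ℚ.* M ÷ p ≡ _÷_ (2 * a * M) (1 * b * p) {{m*n≢0 (1 * b) p {{m*n≢0 1 b}}}}
    product a b = trans (cong (ℚ._* M ÷ p) (÷-* 2 1 a b)) (÷-* (2 * a) (1 * b) M p {{m*n≢0 1 b}})

  below-√3/2-power : fromℕ A <√ fromℕ 2 *√ √3/2 ^√ p *√ fromℚ (M ÷ p)
  below-√3/2-power with halve p
  ... | k , inj₁ p≡ = subst (λ x → Positive (x -√ fromℕ A)) (sym value)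
        (positive-rational A<c refl)
    where
    instance
      4^k≢0 : NonZero (4 ^ k)
      4^k≢0 = m^n≢0 4 k
    c : ℚ
    c = 2 ÷ 1 ℚ.* 3^k/4^k k ℚ.* M ÷ p
    value : fromℕ 2 *√ √3/2 ^√ p *√ fromℚ (M ÷ p) ≡ c +√3· 0ℚ
    value = trans (cong (λ x → fromℕ 2 *√ x *√ fromℚ (M ÷ p)) (trans (cong (√3/2 ^√_) p≡) (√3/2-even k)))
      (trans (fromℚ-*-fromℚ (2 ÷ 1) (3^k/4^k k) 0ℚ (M ÷ p)) (cong (c +√3·_) (ℚ.*-zeroˡ (M ÷ p))))
    A<c : A ÷ 1 ℚ.< c
    A<c = subst (A ÷ 1 ℚ.<_) (sym (product (3 ^ k) (4 ^ k)))
      (÷-< {A} {1} {2 * 3 ^ k * M} {1 * 4 ^ k * p} {{_}} {{m*n≢0 (1 * 4 ^ k) p {{m*n≢0 1 (4 ^ k)}}}} (even-bound k p≡))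
  ... | k , inj₂ p≡ = subst (λ x → Positive (x -√ fromℕ A)) (sym value)
        (positive-irrational {A} {{D≢0}} 0<N (odd-bound k p≡) (ℚ.+-identityˡ _) (trans (ℚ.+-identityʳ c) c≡))
    where
    instance
      4^k≢0 : NonZero (4 ^ k)
      4^k≢0 = m^n≢0 4 k
      2·4^k≢0 : NonZero (2 * 4 ^ k)
      2·4^k≢0 = m*n≢0 2 (4 ^ k)
    D≢0 : NonZero (1 * (2 * 4 ^ k) * p)
    D≢0 = m*n≢0 (1 * (2 * 4 ^ k)) p {{m*n≢0 1 (2 * 4 ^ k)}}
    c : ℚ
    c = 2 ÷ 1 ℚ.* (½ ℚ.* 3^k/4^k k) ℚ.* M ÷ p
    value : fromℕ 2 *√ √3/2 ^√ p *√ fromℚ (M ÷ p) ≡ 0ℚ +√3· c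
    value = trans (cong (λ x → fromℕ 2 *√ x *√ fromℚ (M ÷ p)) (trans (cong (√3/2 ^√_) p≡) (√3/2-odd k)))
      (trans (fromℚ-*-fromℚ (2 ÷ 1) 0ℚ (½ ℚ.* 3^k/4^k k) (M ÷ p)) (cong (_+√3· c) (ℚ.*-zeroˡ (M ÷ p))))
    c≡ : c ≡ _÷_ (2 * (1 * 3 ^ k) * M) (1 * (2 * 4 ^ k) * p) {{D≢0}}
    c≡ = trans (cong (λ v → 2 ÷ 1 ℚ.* v ℚ.* M ÷ p) (÷-* 1 2 (3 ^ k) (4 ^ k))) (product (1 * 3 ^ k) (2 * 4 ^ k))
    0<M : 0 < M
    0<M = *-cancelˡ-< 2 0 M (≤-<-trans z≤n 2^p<2M)
    0<N : 0 < 2 * (1 * 3 ^ k) * M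
    0<N = *-mono-< {0} {2 * (1 * 3 ^ k)} (*-mono-< {0} {2} (s≤s z≤n) (*-mono-< {0} {1} (s≤s z≤n) (m^n>0 3 k))) 0<M

-- Period 2

length≡1 : ∀ {A : Set} {x : A} {xs} → Unique xs → x ∈ xs → (∀ {y z} → y ∈ xs → z ∈ xs → y ≡ z) → length xs ≡ 1
length≡1 {xs = _ ∷ []}    _                   _ _   = refl
length≡1 {xs = _ ∷ _ ∷ _} ((y≢z ∷ _) ∷ _) _ all = ⊥-elim (y≢z (all (here refl) (there (here refl))))

odd : ℕ → Bool
odd zero    = false
odd (suc m) = not (odd m)

2∣⇒¬odd : ∀ {m} → 2 ∣ m → odd m ≡ false
2∣⇒¬odd (divides q refl) = go q
  where
  go : ∀ q → odd (q * 2) ≡ false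
  go zero    = refl
  go (suc q) = trans (not-involutive _) (go q)

¬odd⇒2∣ : ∀ {m} → odd m ≡ false → 2 ∣ m
¬odd⇒2∣ {zero}        _  = divides 0 refl
¬odd⇒2∣ {suc (suc m)} eq with ¬odd⇒2∣ {m} (trans (sym (not-involutive (odd m))) eq)
... | divides q refl = divides (suc q) refl

xor-not : ∀ a b → not a xor not b ≡ a xor b
xor-not true  b = refl
xor-not false b = not-involutive b

module _ (l s : ℕ) (2∣r : 2 ∣ suc s) (2∤ℓ : ¬ 2 ∣ suc l) where
  open Circuit l s
  open Dynamics l s

  -- The state at time 0 under an alternating signal: node `i` shows time `- delay`, which has the
  -- parity of `delay`.
  alternating : Bool → Config n
  alternating b = tabulate λ i → b xor odd (delay (toℕ i))

  odd-l : odd l ≡ false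
  odd-l with odd l in eq
  ... | false = refl
  ... | true  = ⊥-elim (2∤ℓ (¬odd⇒2∣ (cong not eq)))

  odd-s : odd s ≡ true
  odd-s = trans (sym (not-involutive (odd s))) (cong not (2∣⇒¬odd 2∣r))

  lookup-alternating : ∀ b i {d} → delay (toℕ i) ≡ d → lookup (alternating b) i ≡ b xor odd d
  lookup-alternating b i refl = lookup∘tabulate (λ i → b xor odd (delay (toℕ i))) i

  F-alternating : ∀ b → F (alternating b) ≡ alternating (not b)
  F-alternating b = tabulate-cong local-alternating
    where
    x = alternating b
    local-alternating : ∀ i → local x i ≡ not b xor odd (delay (toℕ i))
    local-alternating zero = trans (cong₂ (λ a c → not a ∨ c)
        (trans (last-xᴸ x) (trans (lookup-alternating b leftIndex delay-leftIndex) (cong (b xor_) odd-l)))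
        (trans (last-xᴿ x) (trans (lookup-alternating b (rightIndex s) (delay-rightIndex s)) (cong (b xor_) odd-s))))
      (table b)
      where
      -- The left end has even delay `l` and shows `b`, the right end has odd delay `s` and shows
      -- `not b`; so node 0 receives `not b ∨ not b`.
      table : ∀ b → not (b xor false) ∨ (b xor true) ≡ not b xor false
      table true  = refl
      table false = refl
    local-alternating (suc i) with suc (toℕ i) ≡ᵇ ℓ
    ... | true  = sym (xor-not b false)
    ... | false = trans (lookup-alternating b (inject₁ i) (cong delay (toℕ-inject₁ i))) (sym (xor-not b (odd (delay (toℕ i)))))

  alternating-exact : HasExactPeriod 2 (alternating true)
  alternating-exact = trans (cong F (F-alternating true)) (F-alternating false) , minimal
    where
    minimal : ∀ {d} → d < 2 → 1 ≤ d → ¬ HasPeriod d (alternating true)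
    minimal {1} _ _ eq with () ← cong head (trans (sym (F-alternating true)) eq)
    minimal {suc (suc _)} (s≤s (s≤s ())) _

  signal₂ : ∀ {x y} → HasPeriod 2 x → HasPeriod 2 y →
            signal x 0 ≡ signal y 0 → signal x 1 ≡ signal y 1 → x ≡ y
  signal₂ {x} {y} x≡ y≡ eq₀ eq₁ = signal-injective {2} x≡ y≡ same
    where
    same : ∀ t → signal x t ≡ signal y t
    same 0             = eq₀
    same 1             = eq₁
    same (suc (suc t)) = trans (signal-period {2} x≡ 1 t) (trans (same t) (sym (signal-period {2} y≡ 1 t)))

  F-period : ∀ {x} → HasPeriod 2 x → HasPeriod 2 (F x)
  F-period = cong F

  -- If the two values agreed, `F x` and `x` would emit the same signal and `x` would be a fixed
  -- point.
  signal-alternates : ∀ {x} → HasExactPeriod 2 x → signal x 1 ≡ not (signal x 0)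
  signal-alternates {x} (x≡ , minimal) = ¬-not λ eq →
    minimal ≤-refl ≤-refl (signal₂ (F-period x≡) x≡ eq (trans (cong head x≡) (sym eq)))

  -- Two alternating signals either coincide or differ by one step, and a step does not leave the
  -- orbit.
  orbits-equal₂ : ∀ {x y} → HasExactPeriod 2 x → HasExactPeriod 2 y → orbit 2 x ≡ orbit 2 y
  orbits-equal₂ {x} {y} ex@(x≡ , _) ey@(y≡ , _) with signal x 0 Bool.≟ signal y 0
  ... | yes eq = cong (orbit 2) (signal₂ x≡ y≡ eq
          (trans (signal-alternates ex) (trans (cong not eq) (sym (signal-alternates ey)))))
  ... | no  ne = trans (orbit-iterate l s x≡ 1) (cong (orbit 2) (signal₂ (F-period x≡) y≡ eq
          (trans (cong head x≡) (trans (¬-not ne) (sym (signal-alternates ey))))))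
    where
    eq : signal x 1 ≡ signal y 0
    eq = trans (signal-alternates ex) (trans (cong not (¬-not ne)) (not-involutive _))

  one-attractor : length (attractors 2) ≡ 1
  one-attractor = length≡1 (attractors-unique l s) (∈-attractors⁺ l s alternating-exact) same
    where
    same : ∀ {o o′} → o ∈ attractors 2 → o′ ∈ attractors 2 → o ≡ o′
    same o∈ o′∈ with _ , ex , refl ← ∈-attractors⁻ l s o∈ | _ , ey , refl ← ∈-attractors⁻ l s o′∈
      = orbits-equal₂ ex ey

-- Combination of the counting bound, the Möbius bound and the case of period 2

p≥3 : ∀ {p ℓ} .{{_ : NonZero p}} → ¬ p ∣ ℓ → p ≢ 2 → 3 ≤ p
p≥3 {1}                 p∤ℓ _   = ⊥-elim (p∤ℓ (1∣ _))
p≥3 {2}                 _   p≢2 = ⊥-elim (p≢2 refl)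
p≥3 {suc (suc (suc _))} _   _   = s≤s (s≤s (s≤s z≤n))

proposition5 : (ℓ r p : ℕ) .{{_ : NonZero ℓ}} .{{_ : NonZero r}} .{{_ : NonZero p}} →
    p ∣ r → ¬ (p ∣ ℓ) →
    (p ≢ 2 → fromℕ (A± ℓ r p) <√ fromℕ 2 *√ √3/2 ^√ p *√ fromℚ (A⁺ p))
    × (p ≡ 2 → (A± ℓ r p ≡ 1) × (A⁺ p ≡ 1ℚ))
proposition5 (suc l) (suc s) p p∣r p∤ℓ = strict , λ { refl → one-attractor l s p∣r p∤ℓ , refl }
  where
  strict : p ≢ 2 → fromℕ (A± (suc l) (suc s) p) <√ fromℕ 2 *√ √3/2 ^√ p *√ fromℚ (A⁺ p)
  strict p≢2 = go (möbiusSum-bound p (p≥3 p∤ℓ p≢2))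
    where
    N = A± (suc l) (suc s) p

    go : (∃ λ M → möbiusSum p ≡ ℤ.+ M × 2 ^ p < 2 * M) →
         fromℕ N <√ fromℕ 2 *√ √3/2 ^√ p *√ fromℚ (A⁺ p)
    go (M , M≡ , 2^p<2M) =
      subst (λ m → fromℕ N <√ fromℕ 2 *√ √3/2 ^√ p *√ fromℚ (m ℚ./ p)) (sym M≡)
        (below-√3/2-power N M p (attractors-square-≤ l s p∣r p∤ℓ) 2^p<2M)
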